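{- Let $\Gamma$ be a tight digraph with $\deg(\Gamma)=d\ge 1$ and $\mathrm{ord}(\Gamma)=n$, where $n\neq\Delta_d x^d$ for all $x\in C_d\cap\mathbb{N}$. Then, for an integer $m\geq 1$, the dilate $m\Gamma$ is tight if and only if $1\leq m\leq \mathrm{c}(d,n)$, where $$\mathrm{c}(d,n)=\begin{cases}\beta(d,n)-1 & \text{if }\beta(d,n)\in\mathbb{N},\\ \lfloor\beta(d,n)\rfloor & \text{if }\beta(d,n)\notin\mathbb{N},\end{cases}\qquad\text{with}\qquad \beta(d,n)=\frac{1}{\left\{\sqrt[d]{\frac{n}{\Delta_d}}\right\}}.$$
   Context: In this context "digraph" means a Cayley digraph $\Gamma=\mathrm{Cay}(G,T)$ of a finite Abelian group $G$ with respect to a generating set $T\subset G$ with $0\notin T$: its vertex set is $G$ and its arcs are $g\to g+t$ for $g\in G$, $t\in T$. Its order is $\mathrm{ord}(\Gamma)=|\Gamma|=|G|$, its degree is $\deg(\Gamma)=|T|$, and $k(\Gamma)$ denotes its (directed) diameter. $\mathbb{N}$ is the set of nonnegative integers. For real $x$, the notation $\{x\}$ means $\{x\}=\lceil x\rceil-x$ (not the usual fractional part). The solid density of a digraph $\Gamma$ of degree $d$ and order $n$ is $\delta(\Gamma)=\dfrac{n}{(k(\Gamma)+d)^d}$, and $\Delta_d=\sup\{\delta(\Gamma):\ \deg(\Gamma)=d\}$ (a finite positive real number). Put $\ell(d,n)=\left\lceil\sqrt[d]{n/\Delta_d}\,\right\rceil-d$. The tightness of a digraph $\Gamma$ of degree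 $d$ and order $n$ is $t(d,\Gamma)=k(\Gamma)-\ell(d,n)$, and $\Gamma$ is called tight when $t(d,\Gamma)=0$. Also $C_d=\{x\in\mathbb{R}:\ \Delta_d x^d\in\mathbb{N}\}$. Dilates: let $\Gamma=\mathrm{Cay}(G,\{g_1,\dots,g_d\})$ be a digraph of degree $d$, and let $M\in\mathbb{Z}^{d\times d}$ be a matrix whose columns form a basis of the kernel lattice of $\mathbb{Z}^d\to G$, $(a_1,\dots,a_d)\mapsto\sum_i a_ig_i$. Let $\mathrm{diag}(s_1,\dots,s_d)=UMV$ be a Smith normal form decomposition ($U,V$ unimodular, $s_1\mid\cdots\mid s_d$). Then $\Gamma\cong\mathrm{Cay}(\mathbb{Z}^d/M\mathbb{Z}^d,\{e_1,\dots,e_d\})\cong\mathrm{Cay}(\mathbb{Z}_{s_1}\oplus\cdots\oplus\mathbb{Z}_{s_d},\{Ue_1,\dots,Ue_d\})$, where $e_1,\dots,e_d$ is the canonical basis of $\mathbb{Z}^d$; the set $\{Ue_1,\dots,Ue_d\}$ is called a proper generating set. For an integer $m\ge 1$, the dilate $m\Gamma$ is $m\Gamma=\mathrm{Cay}(\mathbb{Z}_{ms_1}\oplus\cdots\oplus\mathbb{Z}_{ms_d},\{Ue_1,\dots,Ue_d\})\cong\mathrm{Cay}(\mathbb{Z}^d/mM\mathbb{Z}^d,\{e_1,\dots,e_d\})$, a digraph of degree $d$ and order $m^d|\Gamma|$. -}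

module Defs where

open import Algebra.Bundles using (AbelianGroup; CommutativeRing)
import Algebra.Properties.AbelianGroup as AbelianGroupProperties
import Algebra.Properties.CommutativeMonoid.Mult as MonoidMult
import Algebra.Properties.CommutativeMonoid.Sum as MonoidSum
import Algebra.Properties.CommutativeSemigroup as CommutativeSemigroupProperties
import Algebra.Properties.Ring as RingProperties
import Algebra.Properties.Semiring.Exp as SemiringExp
import Algebra.Properties.Semiring.Sum as SemiringSum
open import Data.Fin.Base as Fin using (Fin; zero; suc; toℕ; fromℕ<)
import Data.Fin.Properties as Fin
open import Data.Integer.Base as ℤ using (ℤ; +_; -[1+_]; 0ℤ; 1ℤ)
import Data.Integer.DivMod as ℤ
open import Data.Integer.Divisibility.Signed as ℤ∣ using (divides)
import Data.Integer.Properties as ℤ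
open import Data.Integer.Tactic.RingSolver using (solve-∀)
open import Data.Nat.Base as ℕ using (ℕ; zero; suc; NonZero)
import Data.Nat.Divisibility as ℕ∣
import Data.Nat.Properties as ℕ
open import Data.Product.Base using (∃; _×_; _,_; proj₁; proj₂)
open import Data.Sum.Base using (inj₁; inj₂)
open import Data.Vec.Functional using (Vector; foldr)
open import Function.Base using (_∘_; it)
open import Function.Bundles using (Inverse; _⇔_; Equivalence)
open import Level using (0ℓ; Lift; lift) renaming (suc to lsuc)
open import Relation.Binary.Bundles using (Poset)
open import Relation.Binary.PropositionalEquality as ≡
  using (_≡_; _≢_; cong; cong₂; subst)
open import Relation.Binary.Structures using (IsDecTotalOrder)
open import Relation.Nullary.Decidable using (Dec; yes; no; map′; decidable-stable)
open import Relation.Nullary.Negation using (¬_; contradiction)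
open import Relation.Unary using (Pred; Decidable)

private
  least : ∀ {p} {P : Pred ℕ p} → Decidable P → ∀ n → P n →
          ∃ λ n → P n × (∀ m → P m → n ℕ.≤ m)
  least P? n       Pn with P? 0
  least P? n       Pn | yes P0 = 0 , P0 , λ _ _ → ℕ.z≤n
  least P? zero    Pn | no ¬P0 = contradiction Pn ¬P0
  least P? (suc n) Pn | no ¬P0 with m , Pm , min ← least (P? ∘ suc) n Pn =
    suc m , Pm , λ { zero P0 → contradiction P0 ¬P0
                   ; (suc k) Pk → ℕ.s≤s (min k Pk) }

maximum : ∀ {n} → Vector ℕ n → ℕ
maximum = foldr ℕ._⊔_ 0

≤-maximum : ∀ {n} (f : Vector ℕ n) i → f i ℕ.≤ maximum f
≤-maximum f zero    = ℕ.m≤m⊔n _ _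
≤-maximum f (suc i) =
  ℕ.≤-trans (≤-maximum (f ∘ suc) i) (ℕ.m≤n⊔m (f zero) _)

module Combinations {c ℓ} (A : AbelianGroup c ℓ) where
  open AbelianGroup A
  open MonoidMult commutativeMonoid using () renaming (_×_ to _×ℕ_)
  open MonoidSum commutativeMonoid using (sum; sum-cong-≋; ∑-distrib-+)
  open AbelianGroupProperties A
  open CommutativeSemigroupProperties commutativeSemigroup using (interchange)

  infixr 7.5 _·_

  _·_ : ℤ → Carrier → Carrier
  + n      · g = n ×ℕ g
  -[1+ n ] · g = (suc n ×ℕ g) ⁻¹

  combination : ∀ {d} → Vector ℤ d → Vector Carrier d → Carrier
  combination a g = sum λ i → a i · g i

  ·-congˡ : ∀ {a b} g → a ≡ b → a · g ≈ b · g
  ·-congˡ g ≡.refl = refl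

  combination-cong : ∀ {d} {a b : Vector ℤ d} g → (∀ i → a i ≡ b i) →
                     combination a g ≈ combination b g
  combination-cong g eq = sum-cong-≋ λ i → ·-congˡ (g i) (eq i)

  private
    open import Relation.Binary.Reasoning.Setoid setoid

    ⊖-· : ∀ m n g → (m ℤ.⊖ n) · g ≈ m ×ℕ g ∙ (n ×ℕ g) ⁻¹
    ⊖-· m zero g = sym (trans (∙-congˡ ε⁻¹≈ε) (identityʳ _))
    ⊖-· zero (suc n) g = sym (identityˡ _)
    ⊖-· (suc m) (suc n) g = begin
      (suc m ℤ.⊖ suc n) · g              ≈⟨ ·-congˡ g (ℤ.[1+m]⊖[1+n]≡m⊖n m n) ⟩
      (m ℤ.⊖ n) · g                      ≈⟨ ⊖-· m n g ⟩
      m ×ℕ g ∙ (n ×ℕ g) ⁻¹               ≈⟨ identityˡ _ ⟨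
      ε ∙ (m ×ℕ g ∙ (n ×ℕ g) ⁻¹)         ≈⟨ ∙-congʳ (inverseʳ g) ⟨
      (g ∙ g ⁻¹) ∙ (m ×ℕ g ∙ (n ×ℕ g) ⁻¹) ≈⟨ interchange _ _ _ _ ⟩
      (g ∙ m ×ℕ g) ∙ (g ⁻¹ ∙ (n ×ℕ g) ⁻¹) ≈⟨ ∙-congˡ (⁻¹-∙-comm g _) ⟩
      suc m ×ℕ g ∙ (suc n ×ℕ g) ⁻¹       ∎

    neg-· : ∀ a g → (ℤ.- a) · g ≈ (a · g) ⁻¹
    neg-· (+ zero)  g = sym ε⁻¹≈ε
    neg-· (+ suc n) g = refl
    neg-· -[1+ n ]  g = sym (⁻¹-involutive _)

  ·-homo-+ : ∀ a b g → (a ℤ.+ b) · g ≈ a · g ∙ b · g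
  ·-homo-+ (+ m)    (+ n)    g = MonoidMult.×-homo-+ commutativeMonoid g m n
  ·-homo-+ (+ m)    -[1+ n ] g = ⊖-· m (suc n) g
  ·-homo-+ -[1+ m ] (+ n)    g = trans (⊖-· n (suc m) g) (comm _ _)
  ·-homo-+ -[1+ m ] -[1+ n ] g = begin
    (suc (suc (m ℕ.+ n)) ×ℕ g) ⁻¹         ≡⟨ cong (λ k → (k ×ℕ g) ⁻¹) (cong suc (ℕ.+-suc m n)) ⟨
    ((suc m ℕ.+ suc n) ×ℕ g) ⁻¹           ≈⟨ ⁻¹-cong (MonoidMult.×-homo-+ commutativeMonoid g (suc m) (suc n)) ⟩
    (suc m ×ℕ g ∙ suc n ×ℕ g) ⁻¹          ≈⟨ ⁻¹-∙-comm _ _ ⟨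
    (suc m ×ℕ g) ⁻¹ ∙ (suc n ×ℕ g) ⁻¹     ∎

  combination-homo-+ : ∀ {d} (a b : Vector ℤ d) g →
    combination (λ i → a i ℤ.+ b i) g ≈ combination a g ∙ combination b g
  combination-homo-+ a b g = trans
    (sum-cong-≋ λ i → ·-homo-+ (a i) (b i) (g i))
    (∑-distrib-+ (λ i → a i · g i) (λ i → b i · g i))

  combination-neg : ∀ {d} (a : Vector ℤ d) g →
    combination (λ i → ℤ.- a i) g ≈ combination a g ⁻¹
  combination-neg {zero}  a g = sym ε⁻¹≈ε
  combination-neg {suc d} a g = trans
    (∙-cong (neg-· (a zero) (g zero)) (combination-neg (a ∘ suc) (g ∘ suc)))
    (⁻¹-∙-comm _ _)

-- ℝ is axiomatised as a (classical) complete ordered field, which is unique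
-- up to isomorphism.  The value of 0# ⁻¹ is left unspecified.  Classically
-- archimedean follows from supremum; constructively the bound has to be given.
record CompleteOrderedField : Set₂ where
  infix 4 _≤_
  infix 8 _⁻¹
  field
    commutativeRing : CommutativeRing 0ℓ 0ℓ
  open CommutativeRing commutativeRing public
  open MonoidMult +-commutativeMonoid public using () renaming (_×_ to _×ℕ_)
  field
    _≤_             : Carrier → Carrier → Set
    isDecTotalOrder : IsDecTotalOrder _≈_ _≤_
    0≉1             : ¬ 0# ≈ 1#
    +-monoʳ-≤       : ∀ z {x y} → x ≤ y → z + x ≤ z + y
    *-nonneg        : ∀ {x y} → 0# ≤ x → 0# ≤ y → 0# ≤ x * y
    _⁻¹             : Carrier → Carrier
    ⁻¹-cong         : ∀ {x y} → x ≈ y → x ⁻¹ ≈ y ⁻¹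
    ⁻¹-inverseʳ     : ∀ {x} → ¬ x ≈ 0# → x * x ⁻¹ ≈ 1#

  IsUpperBound : Pred Carrier (lsuc 0ℓ) → Carrier → Set₁
  IsUpperBound P b = ∀ x → P x → x ≤ b

  IsSupremum : Pred Carrier (lsuc 0ℓ) → Carrier → Set₁
  IsSupremum P s = IsUpperBound P s × (∀ b → IsUpperBound P b → s ≤ b)

  field
    archimedean : ∀ x → ∃ λ n → x ≤ n ×ℕ 1#
    supremum    : (P : Pred Carrier (lsuc 0ℓ)) → ∃ P → ∃ (IsUpperBound P) → ∃ (IsSupremum P)

module Reals (ℝ : CompleteOrderedField) where
  open CompleteOrderedField ℝ public
  open IsDecTotalOrder isDecTotalOrder public using (_≟_; _≤?_)
  open SemiringExp semiring public using (_^_)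
  open Combinations +-abelianGroup using (_·_)

  infixl 7 _/_

  _/_ : Carrier → Carrier → Carrier
  x / y = x * y ⁻¹

  fromℕ : ℕ → Carrier
  fromℕ n = n ×ℕ 1#

  fromℤ : ℤ → Carrier
  fromℤ a = a · 1#

  IsNatural : Carrier → Set
  IsNatural x = ∃ λ n → x ≈ fromℕ n

  IsCeiling : Carrier → ℤ → Set
  IsCeiling x a = x ≤ fromℤ a × (∀ b → x ≤ fromℤ b → a ℤ.≤ b)

  IsRoot : ℕ → Carrier → Carrier → Set
  IsRoot d x y = 0# ≤ y × y ^ d ≈ x

module RealsProperties (ℝ : CompleteOrderedField) where
  open Reals ℝ
  open Combinations +-abelianGroup using (·-homo-+; ·-congˡ)
  private
    module ≤ = IsDecTotalOrder isDecTotalOrder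

    ≤-poset : Poset 0ℓ 0ℓ 0ℓ
    ≤-poset = record { isPartialOrder = ≤.isPartialOrder }

  open RingProperties ring
  open import Algebra.Solver.Ring.NaturalCoefficients.Default commutativeSemiring
    using (solve; _:+_; _:*_; _:=_)
  open import Relation.Binary.Reasoning.PartialOrder ≤-poset

  +-monoˡ-≤ : ∀ z {x y} → x ≤ y → x + z ≤ y + z
  +-monoˡ-≤ z {x} {y} x≤y = begin
    x + z ≈⟨ +-comm x z ⟩
    z + x ≤⟨ +-monoʳ-≤ z x≤y ⟩
    z + y ≈⟨ +-comm z y ⟩
    y + z ∎

  +-mono-≤ : ∀ {x y u v} → x ≤ y → u ≤ v → x + u ≤ y + v
  +-mono-≤ x≤y u≤v = ≤.trans (+-monoˡ-≤ _ x≤y) (+-monoʳ-≤ _ u≤v)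

  +-cancelˡ-≤ : ∀ z {x y} → z + x ≤ z + y → x ≤ y
  +-cancelˡ-≤ z {x} {y} z+x≤z+y = begin
    x             ≈⟨ undo x ⟨
    - z + (z + x) ≤⟨ +-monoʳ-≤ (- z) z+x≤z+y ⟩
    - z + (z + y) ≈⟨ undo y ⟩
    y             ∎
    where
    undo : ∀ w → - z + (z + w) ≈ w
    undo w = trans (sym (+-assoc (- z) z w)) (trans (+-congʳ (-‿inverseˡ z)) (+-identityˡ w))

  sub-add : ∀ x y → x + (y - x) ≈ y
  sub-add x y = trans (+-congˡ (+-comm y (- x)))
    (trans (sym (+-assoc x (- x) y)) (trans (+-congʳ (-‿inverseʳ x)) (+-identityˡ y)))

  x≤y⇒0≤y-x : ∀ {x y} → x ≤ y → 0# ≤ y - x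
  x≤y⇒0≤y-x {x} {y} x≤y = +-cancelˡ-≤ x (begin
    x + 0#      ≈⟨ +-identityʳ x ⟩
    x           ≤⟨ x≤y ⟩
    y           ≈⟨ sub-add x y ⟨
    x + (y - x) ∎)

  x≤x+y : ∀ x {y} → 0# ≤ y → x ≤ x + y
  x≤x+y x {y} 0≤y = begin
    x      ≈⟨ +-identityʳ x ⟨
    x + 0# ≤⟨ +-monoʳ-≤ x 0≤y ⟩
    x + y  ∎

  x+y≤x⇒y≤0 : ∀ x {y} → x + y ≤ x → y ≤ 0#
  x+y≤x⇒y≤0 x {y} x+y≤x = +-cancelˡ-≤ x (≤.trans x+y≤x (≤.reflexive (sym (+-identityʳ x))))

  *-monoʳ-≤ : ∀ {z x y} → 0# ≤ z → x ≤ y → z * x ≤ z * y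
  *-monoʳ-≤ {z} {x} {y} 0≤z x≤y = begin
    z * x               ≤⟨ x≤x+y (z * x) (*-nonneg 0≤z (x≤y⇒0≤y-x x≤y)) ⟩
    z * x + z * (y - x) ≈⟨ distribˡ z x (y - x) ⟨
    z * (x + (y - x))   ≈⟨ *-congˡ (sub-add x y) ⟩
    z * y               ∎

  *-monoˡ-≤ : ∀ {z x y} → 0# ≤ z → x ≤ y → x * z ≤ y * z
  *-monoˡ-≤ {z} {x} {y} 0≤z x≤y = begin
    x * z ≈⟨ *-comm x z ⟩
    z * x ≤⟨ *-monoʳ-≤ 0≤z x≤y ⟩
    z * y ≈⟨ *-comm z y ⟩
    y * z ∎

  *-mono-≤ : ∀ {x y u v} → 0# ≤ x → 0# ≤ v → x ≤ y → u ≤ v → x * u ≤ y * v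
  *-mono-≤ 0≤x 0≤v x≤y u≤v = ≤.trans (*-monoʳ-≤ 0≤x u≤v) (*-monoˡ-≤ 0≤v x≤y)

  0≤1 : 0# ≤ 1#
  0≤1 with ≤.total 0# 1#
  ... | inj₁ 0≤1 = 0≤1
  ... | inj₂ 1≤0 = begin
    0#              ≤⟨ *-nonneg 0≤-1 0≤-1 ⟩
    - 1# * - 1#     ≈⟨ -‿distribˡ-* 1# (- 1#) ⟨
    - (1# * - 1#)   ≈⟨ -‿cong (*-identityˡ (- 1#)) ⟩
    - - 1#          ≈⟨ -‿involutive 1# ⟩
    1#              ∎
    where
    0≤-1 : 0# ≤ - 1#
    0≤-1 = ≤.trans (x≤y⇒0≤y-x 1≤0) (≤.reflexive (+-identityˡ (- 1#)))

  1≰0 : ¬ 1# ≤ 0#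
  1≰0 1≤0 = 0≉1 (≤.antisym 0≤1 1≤0)

  ^-nonneg : ∀ {x} d → 0# ≤ x → 0# ≤ x ^ d
  ^-nonneg zero    0≤x = 0≤1
  ^-nonneg (suc d) 0≤x = *-nonneg 0≤x (^-nonneg d 0≤x)

  ^-mono-≤ : ∀ {x y} d → 0# ≤ x → x ≤ y → x ^ d ≤ y ^ d
  ^-mono-≤ zero    0≤x x≤y = ≤.refl
  ^-mono-≤ (suc d) 0≤x x≤y =
    *-mono-≤ 0≤x (^-nonneg d (≤.trans 0≤x x≤y)) x≤y (^-mono-≤ d 0≤x x≤y)

  0≤fromℕ : ∀ n → 0# ≤ fromℕ n
  0≤fromℕ zero    = ≤.refl
  0≤fromℕ (suc n) = ≤.trans 0≤1 (x≤x+y 1# (0≤fromℕ n))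

  fromℕ-mono-≤ : ∀ {m n} → m ℕ.≤ n → fromℕ m ≤ fromℕ n
  fromℕ-mono-≤ {n = n} ℕ.z≤n = 0≤fromℕ n
  fromℕ-mono-≤ (ℕ.s≤s m≤n)   = +-monoʳ-≤ 1# (fromℕ-mono-≤ m≤n)

  fromℕ[1+n]≰0 : ∀ n → ¬ fromℕ (suc n) ≤ 0#
  fromℕ[1+n]≰0 n ≤0 = 1≰0 (≤.trans (x≤x+y 1# (0≤fromℕ n)) ≤0)

  fromℤ-homo-+ : ∀ a b → fromℤ (a ℤ.+ b) ≈ fromℤ a + fromℤ b
  fromℤ-homo-+ a b = ·-homo-+ a b 1#

  fromℤ-cancel-≤ : ∀ a b → fromℤ a ≤ fromℤ b → a ℤ.≤ b
  fromℤ-cancel-≤ a b fa≤fb with a ℤ.≤? b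
  ... | yes a≤b = a≤b
  ... | no  a≰b = contradiction (x+y≤x⇒y≤0 (fromℤ b) b+k≤b) (positive (a ℤ.- b) 0<a-b)
    where
    0<a-b : 0ℤ ℤ.< a ℤ.- b
    0<a-b = subst (ℤ._< a ℤ.- b) (ℤ.+-inverseʳ b) (ℤ.+-monoˡ-< (ℤ.- b) (ℤ.≰⇒> a≰b))
    positive : ∀ c → 0ℤ ℤ.< c → ¬ fromℤ c ≤ 0#
    positive (+ suc n) _ = fromℕ[1+n]≰0 n
    positive (+ zero)  (ℤ.+<+ ())
    b+k≤b : fromℤ b + fromℤ (a ℤ.- b) ≤ fromℤ b
    b+k≤b = begin
      fromℤ b + fromℤ (a ℤ.- b) ≈⟨ fromℤ-homo-+ b (a ℤ.- b) ⟨
      fromℤ (b ℤ.+ (a ℤ.- b))   ≈⟨ ·-congˡ 1# (lemma a b) ⟩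
      fromℤ a                   ≤⟨ fa≤fb ⟩
      fromℤ b                   ∎
      where
      lemma : ∀ a b → b ℤ.+ (a ℤ.- b) ≡ a
      lemma = solve-∀

  fromℕ-cancel-≤ : ∀ m n → fromℕ m ≤ fromℕ n → m ℕ.≤ n
  fromℕ-cancel-≤ m n = ℤ.drop‿+≤+ ∘ fromℤ-cancel-≤ (+ m) (+ n)

  cancel : ∀ a b → (a ℤ.+ b) ℤ.- b ≡ a
  cancel = solve-∀

  cancel′ : ∀ a b → (a ℤ.+ b) ℤ.- a ≡ b
  cancel′ = solve-∀

  ⁻¹-nonneg : ∀ {x} → 0# ≤ x → ¬ x ≈ 0# → 0# ≤ x ⁻¹
  ⁻¹-nonneg {x} 0≤x x≉0 with ≤.total 0# (x ⁻¹)
  ... | inj₁ 0≤x⁻¹ = 0≤x⁻¹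
  ... | inj₂ x⁻¹≤0 = contradiction (begin
    1#        ≈⟨ ⁻¹-inverseʳ x≉0 ⟨
    x * x ⁻¹  ≤⟨ *-monoʳ-≤ 0≤x x⁻¹≤0 ⟩
    x * 0#    ≈⟨ zeroʳ x ⟩
    0#        ∎) 1≰0

  fromℕ-/-≤1 : ∀ {m n} → m ℕ.≤ n → n ≢ 0 → fromℕ m / fromℕ n ≤ 1#
  fromℕ-/-≤1 {m} {n} m≤n n≢0 = begin
    fromℕ m * fromℕ n ⁻¹ ≤⟨ *-monoˡ-≤ (⁻¹-nonneg (0≤fromℕ n) n≉0) (fromℕ-mono-≤ m≤n) ⟩
    fromℕ n * fromℕ n ⁻¹ ≈⟨ ⁻¹-inverseʳ n≉0 ⟩
    1#                   ∎
    where
    n≉0 : ¬ fromℕ n ≈ 0#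
    n≉0 n≈0 = n≢0 (ℕ.n≤0⇒n≡0 (fromℕ-cancel-≤ n 0 (≤.reflexive n≈0)))

  abstract
    isNatural? : Decidable IsNatural
    isNatural? x with M , x≤M ← archimedean x = map′
      (λ (i , x≈i) → toℕ i , x≈i)
      (λ (n , x≈n) →
        let n≤M = fromℕ-cancel-≤ n M (≤.trans (≤.reflexive (sym x≈n)) x≤M) in
        fromℕ< (ℕ.s≤s n≤M) ,
        trans x≈n (reflexive (cong fromℕ (≡.sym (Fin.toℕ-fromℕ< (ℕ.s≤s n≤M))))))
      (Fin.any? {suc M} λ i → x ≟ fromℕ (toℕ i))

    ceiling : ∀ x → ∃ (IsCeiling x)
    ceiling x
      with N , -x≤N ← archimedean (- x)
      with M , x≤M  ← archimedean x
      with j , x≤j-N , j-least ← least (λ j → x ≤? fromℤ (+ j ℤ.- + N)) (M ℕ.+ N) (begin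
             x                             ≤⟨ x≤M ⟩
             fromℤ (+ M)                   ≈⟨ ·-congˡ 1# (cancel (+ M) (+ N)) ⟨
             fromℤ (+ (M ℕ.+ N) ℤ.- + N)   ∎)
      = + j ℤ.- + N , x≤j-N , λ b x≤b →
          let N+b = + N ℤ.+ b
              0≤N+b : 0ℤ ℤ.≤ N+b
              0≤N+b = fromℤ-cancel-≤ 0ℤ N+b (begin
                0#                  ≈⟨ -‿inverseˡ x ⟨
                - x + x             ≤⟨ +-mono-≤ -x≤N x≤b ⟩
                fromℤ (+ N) + fromℤ b ≈⟨ fromℤ-homo-+ (+ N) b ⟨
                fromℤ N+b           ∎)
              b≡ : + ℤ.∣ N+b ∣ ℤ.- + N ≡ b
              b≡ = ≡.trans (cong (ℤ._- + N) (ℤ.0≤i⇒+∣i∣≡i 0≤N+b)) (cancel′ (+ N) b)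
          in subst (+ j ℤ.- + N ℤ.≤_) b≡ (ℤ.+-monoˡ-≤ (ℤ.- + N)
               (ℤ.+≤+ (j-least ℤ.∣ N+b ∣ (≤.trans x≤b (≤.reflexive (·-congˡ 1# (≡.sym b≡)))))))

  ^-increment : ∀ b → 0# ≤ b → ∀ d → ∃ λ K → 0# ≤ K ×
    (∀ y e → 0# ≤ y → y ≤ b → 0# ≤ e → e ≤ 1# → (y + e) ^ d ≤ y ^ d + e * K)
  ^-increment b 0≤b zero = 0# , ≤.refl , λ y e _ _ _ _ → begin
    1#          ≈⟨ +-identityʳ 1# ⟨
    1# + 0#     ≈⟨ +-congˡ (zeroʳ e) ⟨
    1# + e * 0# ∎
  ^-increment b 0≤b (suc d) with K , 0≤K , bound ← ^-increment b 0≤b d =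
    b ^ d + (b * K + 1# * K) ,
    +-nonneg (^-nonneg d 0≤b) (+-nonneg (*-nonneg 0≤b 0≤K) (*-nonneg 0≤1 0≤K)) ,
    λ y e 0≤y y≤b 0≤e e≤1 → begin
      (y + e) * (y + e) ^ d
        ≤⟨ *-monoʳ-≤ (+-nonneg 0≤y 0≤e) (bound y e 0≤y y≤b 0≤e e≤1) ⟩
      (y + e) * (y ^ d + e * K)
        ≈⟨ solve 4 (λ y e p K → (y :+ e) :* (p :+ e :* K) :=
             y :* p :+ e :* (p :+ (y :* K :+ e :* K))) refl y e (y ^ d) K ⟩
      y * y ^ d + e * (y ^ d + (y * K + e * K))
        ≤⟨ +-monoʳ-≤ _ (*-monoʳ-≤ 0≤e (+-mono-≤ (^-mono-≤ d 0≤y y≤b)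
             (+-mono-≤ (*-monoˡ-≤ 0≤K y≤b) (*-monoˡ-≤ 0≤K e≤1)))) ⟩
      y * y ^ d + e * (b ^ d + (b * K + 1# * K)) ∎
    where
    +-nonneg : ∀ {x y} → 0# ≤ x → 0# ≤ y → 0# ≤ x + y
    +-nonneg {x} 0≤x 0≤y = ≤.trans 0≤x (x≤x+y x 0≤y)

  small : ∀ u v K → 0# ≤ K → ¬ v ≤ u → ∃ λ e →
    0# ≤ e × e ≤ 1# × ¬ e ≤ 0# × u + e * (K + 1#) ≤ v
  small u v K 0≤K v≰u = choose (e ≤? 1#)
    where
    L = K + 1#
    1≤L : 1# ≤ L
    1≤L = ≤.trans (x≤x+y 1# 0≤K) (≤.reflexive (+-comm 1# K))
    0≤L : 0# ≤ L
    0≤L = ≤.trans 0≤1 1≤L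
    L≉0 : ¬ L ≈ 0#
    L≉0 L≈0 = 1≰0 (≤.trans 1≤L (≤.reflexive L≈0))
    u≤v : u ≤ v
    u≤v with ≤.total u v
    ... | inj₁ u≤v = u≤v
    ... | inj₂ v≤u = contradiction v≤u v≰u
    e = (v - u) * L ⁻¹
    0≤e : 0# ≤ e
    0≤e = *-nonneg (x≤y⇒0≤y-x u≤v) (⁻¹-nonneg 0≤L L≉0)
    u+eL≈v : u + e * L ≈ v
    u+eL≈v = begin-equality
      u + (v - u) * L ⁻¹ * L   ≈⟨ +-congˡ (*-assoc (v - u) (L ⁻¹) L) ⟩
      u + (v - u) * (L ⁻¹ * L) ≈⟨ +-congˡ (*-congˡ (trans (*-comm (L ⁻¹) L) (⁻¹-inverseʳ L≉0))) ⟩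
      u + (v - u) * 1#         ≈⟨ +-congˡ (*-identityʳ (v - u)) ⟩
      u + (v - u)              ≈⟨ sub-add u v ⟩
      v                        ∎
    e≰0 : ¬ e ≤ 0#
    e≰0 e≤0 = v≰u (begin
      v          ≈⟨ u+eL≈v ⟨
      u + e * L  ≤⟨ +-monoʳ-≤ u (*-monoˡ-≤ 0≤L e≤0) ⟩
      u + 0# * L ≈⟨ +-congˡ (zeroˡ L) ⟩
      u + 0#     ≈⟨ +-identityʳ u ⟩
      u          ∎)
    choose : Dec (e ≤ 1#) → ∃ λ e → 0# ≤ e × e ≤ 1# × ¬ e ≤ 0# × u + e * L ≤ v
    choose (yes e≤1) = e , 0≤e , e≤1 , e≰0 , ≤.reflexive u+eL≈v
    choose (no  e≰1) = 1# , 0≤1 , ≤.refl , 1≰0 ,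
      ≤.trans (+-monoʳ-≤ u (*-monoˡ-≤ 0≤L 1≤e)) (≤.reflexive u+eL≈v)
      where
      1≤e : 1# ≤ e
      1≤e with ≤.total 1# e
      ... | inj₁ 1≤e = 1≤e
      ... | inj₂ e≤1 = contradiction e≤1 e≰1

  1≤y^ : ∀ {y} k → 1# ≤ y → 1# ≤ y ^ k
  1≤y^ {y} zero    1≤y = ≤.refl
  1≤y^ {y} (suc k) 1≤y = begin
    1#        ≈⟨ *-identityʳ 1# ⟨
    1# * 1#   ≤⟨ *-mono-≤ 0≤1 (≤.trans 0≤1 (1≤y^ k 1≤y)) 1≤y (1≤y^ k 1≤y) ⟩
    y * y ^ k ∎

  Subroot : ℕ → Carrier → Pred Carrier (lsuc 0ℓ)
  Subroot d x y = Lift (lsuc 0ℓ) (0# ≤ y × y ^ d ≤ x)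

  Subroot-0 : ∀ d .{{_ : NonZero d}} {x} → 0# ≤ x → Subroot d x 0#
  Subroot-0 (suc d) 0≤x = lift (≤.refl , ≤.trans (≤.reflexive (zeroˡ _)) 0≤x)

  Subroot-bounded : ∀ d .{{_ : NonZero d}} {x} → 0# ≤ x → IsUpperBound (Subroot d x) (1# + x)
  Subroot-bounded (suc d) {x} 0≤x y (lift (0≤y , y^d≤x)) with ≤.total y 1#
  ... | inj₁ y≤1 = ≤.trans y≤1 (x≤x+y 1# 0≤x)
  ... | inj₂ 1≤y = begin
    y             ≈⟨ *-identityʳ y ⟨
    y * 1#        ≤⟨ *-monoʳ-≤ 0≤y (1≤y^ d 1≤y) ⟩
    y * y ^ d     ≤⟨ y^d≤x ⟩
    x             ≤⟨ x≤x+y x 0≤1 ⟩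
    x + 1#        ≈⟨ +-comm x 1# ⟩
    1# + x        ∎

  module _ d {x s K} (sup : IsSupremum (Subroot d x) s) (0≤s : 0# ≤ s) (0≤K : 0# ≤ K)
    (increment : ∀ y e → 0# ≤ y → y ≤ s → 0# ≤ e → e ≤ 1# → (y + e) ^ d ≤ y ^ d + e * K)
    where

    Gap : Carrier → Carrier → Set
    Gap u v = ∃ λ e → 0# ≤ e × e ≤ 1# × ¬ e ≤ 0# × u + e * (K + 1#) ≤ v

    no-gap-above : ¬ Gap (s ^ d) x
    no-gap-above (e , 0≤e , e≤1 , e≰0 , gap) = e≰0 (x+y≤x⇒y≤0 s
      (proj₁ sup (s + e) (lift (≤.trans 0≤s (x≤x+y s 0≤e) , (begin
        (s + e) ^ d           ≤⟨ increment s e 0≤s ≤.refl 0≤e e≤1 ⟩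
        s ^ d + e * K         ≤⟨ +-monoʳ-≤ (s ^ d) (*-monoʳ-≤ 0≤e (x≤x+y K 0≤1)) ⟩
        s ^ d + e * (K + 1#)  ≤⟨ gap ⟩
        x                     ∎)))))

    s-e+e≈s : ∀ e → (s - e) + e ≈ s
    s-e+e≈s e = trans (+-comm (s - e) e) (sub-add e s)

    gap-bound : ((e , _) : Gap x (s ^ d)) → IsUpperBound (Subroot d x) (s - e)
    gap-bound (e , 0≤e , e≤1 , e≰0 , gap) y (lift (0≤y , y^d≤x)) with ≤.total y (s - e)
    ... | inj₁ y≤s-e = y≤s-e
    ... | inj₂ s-e≤y = contradiction (x+y≤x⇒y≤0 (x + e * K) (begin
      x + e * K + e        ≈⟨ +-assoc x (e * K) e ⟩
      x + (e * K + e)      ≈⟨ +-congˡ (+-congˡ (*-identityʳ e)) ⟨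
      x + (e * K + e * 1#) ≈⟨ +-congˡ (distribˡ e K 1#) ⟨
      x + e * (K + 1#)     ≤⟨ gap ⟩
      s ^ d                ≤⟨ ^-mono-≤ d 0≤s s≤y+e ⟩
      (y + e) ^ d          ≤⟨ increment y e 0≤y (proj₁ sup y (lift (0≤y , y^d≤x))) 0≤e e≤1 ⟩
      y ^ d + e * K        ≤⟨ +-monoˡ-≤ (e * K) y^d≤x ⟩
      x + e * K            ∎)) e≰0
      where
      s≤y+e : s ≤ y + e
      s≤y+e = begin
        s           ≈⟨ s-e+e≈s e ⟨
        (s - e) + e ≤⟨ +-monoˡ-≤ e s-e≤y ⟩
        y + e       ∎

    no-gap-below : ¬ Gap x (s ^ d)
    no-gap-below g@(e , 0≤e , e≤1 , e≰0 , gap) = e≰0 (x+y≤x⇒y≤0 (s - e) (begin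
      (s - e) + e ≈⟨ s-e+e≈s e ⟩
      s           ≤⟨ proj₂ sup (s - e) (gap-bound g) ⟩
      s - e       ∎))

    supremum-root : s ^ d ≈ x
    supremum-root = ≤.antisym
      (decidable-stable (s ^ d ≤? x) λ s^d≰x → no-gap-below (small x (s ^ d) K 0≤K s^d≰x))
      (decidable-stable (x ≤? s ^ d) λ x≰s^d → no-gap-above (small (s ^ d) x K 0≤K x≰s^d))

  abstract
    root-exists : ∀ d .{{_ : NonZero d}} {x} → 0# ≤ x → ∃ (IsRoot d x)
    root-exists d {x} 0≤x =
      let s , sup = supremum (Subroot d x) (0# , Subroot-0 d 0≤x) (1# + x , Subroot-bounded d 0≤x)
          0≤s = proj₁ sup 0# (Subroot-0 d 0≤x)
          K , 0≤K , increment = ^-increment s 0≤s d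
      in s , 0≤s , supremum-root d sup 0≤s 0≤K increment

module RealFunctions (ℝ : CompleteOrderedField) where
  open Reals ℝ
  open RealsProperties ℝ using (ceiling; root-exists)

  ⌈_⌉ : Carrier → ℤ
  ⌈ x ⌉ = proj₁ (ceiling x)

  ⌊_⌋ : Carrier → ℤ
  ⌊ x ⌋ = ℤ.- ⌈ - x ⌉

  -- Denoted {x}; not the usual fractional part x - ⌊x⌋.
  ⟦_⟧ : Carrier → Carrier
  ⟦ x ⟧ = fromℤ ⌈ x ⌉ - x

  -- The value at negative numbers is a dummy.
  root : (d : ℕ) .{{_ : NonZero d}} → Carrier → Carrier
  root d x with 0# ≤? x
  ... | yes 0≤x = proj₁ (root-exists d 0≤x)
  ... | no  _   = 0#

record CayleyDigraph (d : ℕ) : Set₁ where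
  field
    abelianGroup : AbelianGroup 0ℓ 0ℓ
  open AbelianGroup abelianGroup public
  open Combinations abelianGroup public
  field
    ord           : ℕ
    enumeration   : Inverse (≡.setoid (Fin ord)) setoid
    -- The generating set T is {gen i ∣ i}; injectivity makes its size d.
    gen           : Fin d → Carrier
    gen-injective : ∀ {i j} → gen i ≈ gen j → i ≡ j
    gen≉ε         : ∀ i → ¬ gen i ≈ ε
    gen-generates : ∀ g → ∃ λ a → combination a gen ≈ g

  Arc : Carrier → Carrier → Set
  Arc u v = ∃ λ i → v ≈ u ∙ gen i

  Walk : ℕ → Carrier → Carrier → Set
  Walk zero    u v = u ≈ v
  Walk (suc l) u v = ∃ λ w → Arc u w × Walk l w v

  IsDistance : Carrier → Carrier → ℕ → Set
  IsDistance u v l = Walk l u v × (∀ l′ → Walk l′ u v → l ℕ.≤ l′)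

  element : Fin ord → Carrier
  element = Inverse.to enumeration

  index : Carrier → Fin ord
  index = Inverse.from enumeration

  element-index : ∀ g → element (index g) ≈ g
  element-index g = Inverse.inverseˡ enumeration ≡.refl

  private
    open MonoidMult commutativeMonoid using (×-homo-+) renaming (_×_ to _×ℕ_)
    open MonoidSum commutativeMonoid using (sum)
    open AbelianGroupProperties abelianGroup
    open import Relation.Binary.Reasoning.Setoid setoid

    index-injective : ∀ {g h} → index g ≡ index h → g ≈ h
    index-injective {g} {h} eq = begin
      g                 ≈⟨ element-index g ⟨
      element (index g) ≡⟨ cong element eq ⟩
      element (index h) ≈⟨ element-index h ⟩
      h                 ∎

    _≈?_ : ∀ g h → Dec (g ≈ h)
    g ≈? h = map′ index-injective (Inverse.from-cong enumeration)
                  (index g Fin.≟ index h)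

  walk-respʳ : ∀ {u v w} l → v ≈ w → Walk l u v → Walk l u w
  walk-respʳ zero    v≈w u≈v             = trans u≈v v≈w
  walk-respʳ (suc l) v≈w (x , arc , walk) = x , arc , walk-respʳ l v≈w walk

  walk-respˡ : ∀ {u v w} l → u ≈ v → Walk l u w → Walk l v w
  walk-respˡ zero    u≈v u≈w = trans (sym u≈v) u≈w
  walk-respˡ (suc l) u≈v (x , (i , x≈ug) , walk) =
    x , (i , trans x≈ug (∙-congʳ u≈v)) , walk

  walk-++ : ∀ {u v w} k {l} → Walk k u v → Walk l v w → Walk (k ℕ.+ l) u w
  walk-++ zero {l} u≈v vw             = walk-respˡ l (sym u≈v) vw
  walk-++ (suc k) (x , arc , walk) vw = x , arc , walk-++ k walk vw

  walk? : ∀ l u v → Dec (Walk l u v)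
  walk? zero    u v = u ≈? v
  walk? (suc l) u v = map′
    (λ (i , walk) → u ∙ gen i , (i , refl) , walk)
    (λ (x , (i , x≈ug) , walk) → i , walk-respˡ l x≈ug walk)
    (Fin.any? λ i → walk? l (u ∙ gen i) v)

  private
    Reachable : Carrier → Set
    Reachable g = ∀ u → ∃ λ l → Walk l u (u ∙ g)

    reachable-resp : ∀ {g h} → g ≈ h → Reachable g → Reachable h
    reachable-resp g≈h rg u with l , walk ← rg u =
      l , walk-respʳ l (∙-congˡ g≈h) walk

    reachable-ε : Reachable ε
    reachable-ε u = 0 , sym (identityʳ u)

    reachable-∙ : ∀ {g h} → Reachable g → Reachable h → Reachable (g ∙ h)
    reachable-∙ {g} {h} rg rh u with k , walk₁ ← rg u with l , walk₂ ← rh (u ∙ g) =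
      k ℕ.+ l , walk-respʳ (k ℕ.+ l) (assoc u g h) (walk-++ k walk₁ walk₂)

    reachable-× : ∀ {g} n → Reachable g → Reachable (n ×ℕ g)
    reachable-× zero    rg = reachable-ε
    reachable-× (suc n) rg = reachable-∙ rg (reachable-× n rg)

    ⁻¹-multiple : ∀ g → ∃ λ n → n ×ℕ g ≈ g ⁻¹
    ⁻¹-multiple g
      with i , j , i<j , fi≡fj ←
        Fin.pigeonhole (ℕ.n<1+n ord) (λ i → index (toℕ i ×ℕ g))
      with k , eq ← ℕ.m≤n⇒∃[o]m+o≡n i<j
      = k , inverseʳ-unique g (k ×ℕ g) (identityʳ-unique (toℕ i ×ℕ g) _ (begin
        toℕ i ×ℕ g ∙ suc k ×ℕ g  ≈⟨ ×-homo-+ g (toℕ i) (suc k) ⟨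
        (toℕ i ℕ.+ suc k) ×ℕ g   ≡⟨ cong (_×ℕ g) (≡.trans (ℕ.+-suc (toℕ i) k) eq) ⟩
        toℕ j ×ℕ g               ≈⟨ index-injective fi≡fj ⟨
        toℕ i ×ℕ g               ∎))

    reachable-· : ∀ {g} a → Reachable g → Reachable (a · g)
    reachable-· (+ n) rg = reachable-× n rg
    reachable-· {g} -[1+ n ] rg with k , eq ← ⁻¹-multiple (suc n ×ℕ g) =
      reachable-resp eq (reachable-× k (reachable-× (suc n) rg))

    reachable-sum : ∀ {m} (h : Vector Carrier m) →
                    (∀ i → Reachable (h i)) → Reachable (sum h)
    reachable-sum {zero}  h rh = reachable-ε
    reachable-sum {suc m} h rh =
      reachable-∙ (rh zero) (reachable-sum (h ∘ suc) (rh ∘ suc))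

    reachable-gen : ∀ i → Reachable (gen i)
    reachable-gen i u = 1 , u ∙ gen i , (i , refl) , refl

  connected : ∀ u v → ∃ λ l → Walk l u v
  connected u v
    with a , eq ← gen-generates (u ⁻¹ ∙ v)
    with l , walk ← reachable-sum _ (λ i → reachable-· (a i) (reachable-gen i)) u
    = l , walk-respʳ l (begin
        u ∙ combination a gen  ≈⟨ ∙-congˡ eq ⟩
        u ∙ (u ⁻¹ ∙ v)         ≈⟨ assoc _ _ _ ⟨
        (u ∙ u ⁻¹) ∙ v         ≈⟨ ∙-congʳ (inverseʳ u) ⟩
        ε ∙ v                  ≈⟨ identityˡ v ⟩
        v                      ∎) walk

  abstract
    distance : ∀ u v → ∃ (IsDistance u v)
    distance u v with l , walk ← connected u v = least (λ k → walk? k u v) l walk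

  dist : Carrier → Carrier → ℕ
  dist u v = proj₁ (distance u v)

  diameter : ℕ
  diameter = maximum λ i → maximum λ j → dist (element i) (element j)

  private
    dist-element≤diameter : ∀ i j → dist (element i) (element j) ℕ.≤ diameter
    dist-element≤diameter i j = ℕ.≤-trans
      (≤-maximum (λ j → dist (element i) (element j)) j)
      (≤-maximum (λ i → maximum λ j → dist (element i) (element j)) i)

  dist≤diameter : ∀ u v → dist u v ℕ.≤ diameter
  dist≤diameter u v = ℕ.≤-trans
    (proj₂ (proj₂ (distance u v)) l
      (walk-respʳ l (element-index v) (walk-respˡ l (element-index u) walk)))
    (dist-element≤diameter (index u) (index v))
    where
    l = dist (element (index u)) (element (index v))
    walk = proj₁ (proj₂ (distance (element (index u)) (element (index v))))

  private
    δ[_] : ∀ {m} → Fin m → Fin m → ℕ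
    δ[ zero ]  zero    = 1
    δ[ zero ]  (suc j) = 0
    δ[ suc i ] zero    = 0
    δ[ suc i ] (suc j) = δ[ i ] j

    δ[_]≤1 : ∀ {m} (i j : Fin m) → δ[ i ] j ℕ.≤ 1
    δ[ zero  ]≤1 zero    = ℕ.≤-refl
    δ[ zero  ]≤1 (suc j) = ℕ.z≤n
    δ[ suc i ]≤1 zero    = ℕ.z≤n
    δ[ suc i ]≤1 (suc j) = δ[ i ]≤1 j

    sum-0× : ∀ {m} (h : Vector Carrier m) → sum (λ i → 0 ×ℕ h i) ≈ ε
    sum-0× {zero}  h = refl
    sum-0× {suc m} h = trans (identityˡ _) (sum-0× (h ∘ suc))

    sum-δ : ∀ {m} (i : Fin m) (h : Vector Carrier m) →
            sum (λ j → δ[ i ] j ×ℕ h j) ≈ h i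
    sum-δ zero h = trans (∙-cong (identityʳ _) (sum-0× (h ∘ suc))) (identityʳ _)
    sum-δ (suc i) h = trans (identityˡ _) (sum-δ i (h ∘ suc))

    sum-homo : ∀ {m} (a b : Vector ℕ m) (h : Vector Carrier m) →
      sum (λ j → (a j ℕ.+ b j) ×ℕ h j) ≈ sum (λ j → a j ×ℕ h j) ∙ sum (λ j → b j ×ℕ h j)
    sum-homo a b h = trans
      (MonoidSum.sum-cong-≋ commutativeMonoid λ j → ×-homo-+ (h j) (a j) (b j))
      (MonoidSum.∑-distrib-+ commutativeMonoid (λ j → a j ×ℕ h j) (λ j → b j ×ℕ h j))

  -- The numbers of times each generator is used along a walk.
  steps : ∀ l {u v} → Walk l u v →
    ∃ λ (a : Vector ℕ d) → (∀ i → a i ℕ.≤ l) × v ≈ u ∙ sum (λ i → a i ×ℕ gen i)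
  steps zero {u} {v} u≈v = (λ _ → 0) , (λ _ → ℕ.z≤n) ,
    sym (trans (∙-congˡ (sum-0× gen)) (trans (identityʳ u) u≈v))
  steps (suc l) {u} {v} (w , (i , w≈) , walk) with a , a≤l , v≈ ← steps l walk =
    (λ j → δ[ i ] j ℕ.+ a j) , (λ j → ℕ.+-mono-≤ (δ[ i ]≤1 j) (a≤l j)) , (begin
      v                                          ≈⟨ v≈ ⟩
      w ∙ sum (λ j → a j ×ℕ gen j)               ≈⟨ ∙-congʳ w≈ ⟩
      u ∙ gen i ∙ sum (λ j → a j ×ℕ gen j)       ≈⟨ assoc _ _ _ ⟩
      u ∙ (gen i ∙ sum (λ j → a j ×ℕ gen j))     ≈⟨ ∙-congˡ (∙-congʳ (sum-δ i gen)) ⟨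
      u ∙ (sum (λ j → δ[ i ] j ×ℕ gen j) ∙ sum (λ j → a j ×ℕ gen j))
                                                 ≈⟨ ∙-congˡ (sum-homo δ[ i ] a gen) ⟨
      u ∙ sum (λ j → (δ[ i ] j ℕ.+ a j) ×ℕ gen j) ∎)

  ord≤[1+diameter]^d : ord ℕ.≤ suc diameter ℕ.^ d
  ord≤[1+diameter]^d = Fin.injective⇒≤ {f = Fin.funToFin ∘ digits} injective
    where
    coords : ∀ x → ∃ λ (a : Vector ℕ d) →
      (∀ i → a i ℕ.≤ dist ε (element x)) × element x ≈ ε ∙ sum (λ i → a i ×ℕ gen i)
    coords x = steps _ (proj₁ (proj₂ (distance ε (element x))))

    digits : Fin ord → Fin d → Fin (suc diameter)
    digits x i = fromℕ< (ℕ.s≤s (ℕ.≤-trans (proj₁ (proj₂ (coords x)) i) (dist≤diameter _ _)))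

    same : ∀ {x y} → (∀ i → digits x i ≡ digits y i) →
           ∀ i → proj₁ (coords x) i ≡ proj₁ (coords y) i
    same eq i = ≡.trans (≡.sym (Fin.toℕ-fromℕ< _)) (≡.trans (cong toℕ (eq i)) (Fin.toℕ-fromℕ< _))

    injective : ∀ {x y} → Fin.funToFin (digits x) ≡ Fin.funToFin (digits y) → x ≡ y
    injective {x} {y} eq = x≡y
      where
      dx≡dy : ∀ i → digits x i ≡ digits y i
      dx≡dy i = ≡.trans (≡.sym (Fin.finToFun-funToFin (digits x) i))
        (≡.trans (cong (λ z → Fin.finToFun z i) eq) (Fin.finToFun-funToFin (digits y) i))
      ex≈ey : element x ≈ element y
      ex≈ey = begin
        element x                                 ≈⟨ proj₂ (proj₂ (coords x)) ⟩
        ε ∙ sum (λ i → proj₁ (coords x) i ×ℕ gen i)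
          ≈⟨ ∙-congˡ (MonoidSum.sum-cong-≋ commutativeMonoid λ i →
               reflexive (cong (_×ℕ gen i) (same dx≡dy i))) ⟩
        ε ∙ sum (λ i → proj₁ (coords y) i ×ℕ gen i) ≈⟨ proj₂ (proj₂ (coords y)) ⟨
        element y                                 ∎
      x≡y : x ≡ y
      x≡y = ≡.trans (≡.sym (Inverse.inverseʳ enumeration refl))
                       (Inverse.inverseʳ enumeration ex≈ey)

module ℤΣ = SemiringSum (CommutativeRing.semiring ℤ.+-*-commutativeRing)

Matrix : ℕ → Set
Matrix d = Fin d → Fin d → ℤ

identity : ∀ {d} → Matrix d
identity zero    zero    = 1ℤ
identity zero    (suc j) = 0ℤ
identity (suc i) zero    = 0ℤ
identity (suc i) (suc j) = identity i j

diagonal : ∀ {d} → (Fin d → ℕ) → Matrix d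
diagonal s i j = + s i ℤ.* identity i j

infixl 7 _⊠_ _*ᵥ_

_⊠_ : ∀ {d} → Matrix d → Matrix d → Matrix d
(A ⊠ B) i j = ℤΣ.sum λ k → A i k ℤ.* B k j

_*ᵥ_ : ∀ {d} → Matrix d → Vector ℤ d → Vector ℤ d
(A *ᵥ x) i = ℤΣ.sum λ j → A i j ℤ.* x j

infix 4 _≐_

_≐_ : ∀ {d} → Matrix d → Matrix d → Set
A ≐ B = ∀ i j → A i j ≡ B i j

-- Invertibility over ℤ, equivalently determinant ±1.
Unimodular : ∀ {d} → Matrix d → Set
Unimodular A = ∃ λ B → A ⊠ B ≐ identity × B ⊠ A ≐ identity

module MatrixProperties where
  open ≡.≡-Reasoning

  sum-0 : ∀ {d} (f : Vector ℤ d) → (∀ i → f i ≡ 0ℤ) → ℤΣ.sum f ≡ 0ℤ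
  sum-0 {d} f f≡0 = ≡.trans (ℤΣ.sum-cong-≗ f≡0) (ℤΣ.sum-replicate-zero d)

  identity-*ᵥ : ∀ {d} (x : Vector ℤ d) i → (identity *ᵥ x) i ≡ x i
  identity-*ᵥ x zero = begin
    1ℤ ℤ.* x zero ℤ.+ ℤΣ.sum (λ j → 0ℤ ℤ.* x (suc j))
      ≡⟨ cong₂ ℤ._+_ (ℤ.*-identityˡ (x zero)) (sum-0 (λ j → 0ℤ ℤ.* x (suc j)) λ _ → ≡.refl) ⟩
    x zero ℤ.+ 0ℤ ≡⟨ ℤ.+-identityʳ (x zero) ⟩
    x zero        ∎
  identity-*ᵥ x (suc i) = ≡.trans (ℤ.+-identityˡ _) (identity-*ᵥ (x ∘ suc) i)

  *ᵥ-identity : ∀ {d} (A : Matrix d) j i → (A *ᵥ λ k → identity k j) i ≡ A i j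
  *ᵥ-identity A j i = column (A i) j
    where
    column : ∀ {d} (a : Vector ℤ d) j → ℤΣ.sum (λ k → a k ℤ.* identity k j) ≡ a j
    column a zero = begin
      a zero ℤ.* 1ℤ ℤ.+ ℤΣ.sum (λ k → a (suc k) ℤ.* 0ℤ)
        ≡⟨ cong₂ ℤ._+_ (ℤ.*-identityʳ (a zero)) (sum-0 (λ k → a (suc k) ℤ.* 0ℤ) λ k → ℤ.*-zeroʳ (a (suc k))) ⟩
      a zero ℤ.+ 0ℤ ≡⟨ ℤ.+-identityʳ (a zero) ⟩
      a zero        ∎
    column a (suc j) = begin
      a zero ℤ.* 0ℤ ℤ.+ ℤΣ.sum (λ k → a (suc k) ℤ.* identity k j)
        ≡⟨ cong₂ ℤ._+_ (ℤ.*-zeroʳ (a zero)) (column (a ∘ suc) j) ⟩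
      0ℤ ℤ.+ a (suc j) ≡⟨ ℤ.+-identityˡ _ ⟩
      a (suc j)        ∎

  diagonal-*ᵥ : ∀ {d} (s : Fin d → ℕ) x i → (diagonal s *ᵥ x) i ≡ + s i ℤ.* x i
  diagonal-*ᵥ s x i = begin
    ℤΣ.sum (λ j → + s i ℤ.* identity i j ℤ.* x j)
      ≡⟨ ℤΣ.sum-cong-≗ (λ j → ℤ.*-assoc (+ s i) (identity i j) (x j)) ⟩
    ℤΣ.sum (λ j → + s i ℤ.* (identity i j ℤ.* x j))
      ≡⟨ ℤΣ.*-distribˡ-sum (+ s i) (λ j → identity i j ℤ.* x j) ⟨
    + s i ℤ.* (identity *ᵥ x) i ≡⟨ cong (+ s i ℤ.*_) (identity-*ᵥ x i) ⟩
    + s i ℤ.* x i               ∎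

  *ᵥ-cong : ∀ {d} {A B : Matrix d} {x y : Vector ℤ d} → A ≐ B →
            (∀ i → x i ≡ y i) → ∀ i → (A *ᵥ x) i ≡ (B *ᵥ y) i
  *ᵥ-cong A≐B x≡y i = ℤΣ.sum-cong-≗ λ j → cong₂ ℤ._*_ (A≐B i j) (x≡y j)

  *ᵥ-congʳ : ∀ {d} (A : Matrix d) {x y : Vector ℤ d} →
             (∀ i → x i ≡ y i) → ∀ i → (A *ᵥ x) i ≡ (A *ᵥ y) i
  *ᵥ-congʳ A = *ᵥ-cong {A = A} λ _ _ → ≡.refl

  *ᵥ-0 : ∀ {d} (A : Matrix d) {x : Vector ℤ d} → (∀ i → x i ≡ 0ℤ) → ∀ i → (A *ᵥ x) i ≡ 0ℤ
  *ᵥ-0 A x≡0 i = sum-0 _ λ j → ≡.trans (cong (A i j ℤ.*_) (x≡0 j)) (ℤ.*-zeroʳ (A i j))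

  *ᵥ-+ : ∀ {d} (A : Matrix d) (x y : Vector ℤ d) i →
         (A *ᵥ λ j → x j ℤ.+ y j) i ≡ (A *ᵥ x) i ℤ.+ (A *ᵥ y) i
  *ᵥ-+ A x y i = ≡.trans
    (ℤΣ.sum-cong-≗ λ j → ℤ.*-distribˡ-+ (A i j) (x j) (y j))
    (ℤΣ.∑-distrib-+ (λ j → A i j ℤ.* x j) (λ j → A i j ℤ.* y j))

  *ᵥ-neg : ∀ {d} (A : Matrix d) (x : Vector ℤ d) i →
           (A *ᵥ λ j → ℤ.- x j) i ≡ ℤ.- (A *ᵥ x) i
  *ᵥ-neg A x i = begin
    (A *ᵥ λ j → ℤ.- x j) i
      ≡⟨ ℤΣ.sum-cong-≗ (λ j → ≡.trans (≡.sym (ℤ.neg-distribʳ-* (A i j) (x j)))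
                                      (≡.sym (ℤ.-1*i≡-i _))) ⟩
    ℤΣ.sum (λ j → ℤ.-1ℤ ℤ.* (A i j ℤ.* x j))
      ≡⟨ ℤΣ.*-distribˡ-sum ℤ.-1ℤ (λ j → A i j ℤ.* x j) ⟨
    ℤ.-1ℤ ℤ.* (A *ᵥ x) i ≡⟨ ℤ.-1*i≡-i _ ⟩
    ℤ.- (A *ᵥ x) i       ∎

  ⊠-*ᵥ : ∀ {d} (A B : Matrix d) x i → (A ⊠ B *ᵥ x) i ≡ (A *ᵥ (B *ᵥ x)) i
  ⊠-*ᵥ {d} A B x i = begin
    ℤΣ.sum (λ j → ℤΣ.sum (λ k → A i k ℤ.* B k j) ℤ.* x j)
      ≡⟨ ℤΣ.sum-cong-≗ (λ j → ℤΣ.*-distribʳ-sum (x j) (λ k → A i k ℤ.* B k j)) ⟩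
    ℤΣ.sum (λ j → ℤΣ.sum (λ k → A i k ℤ.* B k j ℤ.* x j))
      ≡⟨ ℤΣ.∑-comm (λ j k → A i k ℤ.* B k j ℤ.* x j) ⟩
    ℤΣ.sum (λ k → ℤΣ.sum (λ j → A i k ℤ.* B k j ℤ.* x j))
      ≡⟨ ℤΣ.sum-cong-≗ (λ k → ℤΣ.sum-cong-≗ (λ j → ℤ.*-assoc (A i k) (B k j) (x j))) ⟩
    ℤΣ.sum (λ k → ℤΣ.sum (λ j → A i k ℤ.* (B k j ℤ.* x j)))
      ≡⟨ ℤΣ.sum-cong-≗ (λ k → ℤΣ.*-distribˡ-sum (A i k) (λ j → B k j ℤ.* x j)) ⟨
    (A *ᵥ (B *ᵥ x)) i ∎

  cancelˡ : ∀ {d} (A B : Matrix d) → A ⊠ B ≐ identity →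
            ∀ x i → (A *ᵥ (B *ᵥ x)) i ≡ x i
  cancelˡ A B AB≐1 x i = begin
    (A *ᵥ (B *ᵥ x)) i    ≡⟨ ⊠-*ᵥ A B x i ⟨
    (A ⊠ B *ᵥ x) i       ≡⟨ *ᵥ-cong AB≐1 (λ _ → ≡.refl) i ⟩
    (identity *ᵥ x) i    ≡⟨ identity-*ᵥ x i ⟩
    x i                  ∎

open MatrixProperties
open ≡.≡-Reasoning

identity-unimodular : ∀ {d} → Unimodular (identity {d})
identity-unimodular = identity , square , square
  where
  square : ∀ {d} → identity {d} ⊠ identity ≐ identity
  square i j = *ᵥ-identity identity j i

-- ℤ/q₁ ⊕ ⋯ ⊕ ℤ/q_d, realised on ℤᵈ with coordinatewise congruence.
cyclicSum : ∀ {d} → (Fin d → ℕ) → AbelianGroup 0ℓ 0ℓ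
cyclicSum {d} q = record
  { Carrier = Vector ℤ d
  ; _≈_     = λ x y → ∀ i → + q i ℤ∣.∣ x i ℤ.- y i
  ; _∙_     = λ x y i → x i ℤ.+ y i
  ; ε       = λ _ → 0ℤ
  ; _⁻¹     = λ x i → ℤ.- x i
  ; isAbelianGroup = record
    { isGroup = record
      { isMonoid = record
        { isSemigroup = record
          { isMagma = record
            { isEquivalence = record
              { refl  = λ {x} i → ≡⇒ i {x i} ≡.refl
              ; sym   = λ {x} {y} p i → subst (+ q i ℤ∣.∣_) (flip (x i) (y i)) (ℤ∣.∣m⇒∣-m (p i))
              ; trans = λ {x} {y} {z} p r i →
                  subst (+ q i ℤ∣.∣_) (chain (x i) (y i) (z i)) (ℤ∣.∣m∣n⇒∣m+n (p i) (r i))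
              }
            ; ∙-cong = λ {x} {y} {u} {v} p r i →
                subst (+ q i ℤ∣.∣_) (plus (x i) (y i) (u i) (v i)) (ℤ∣.∣m∣n⇒∣m+n (p i) (r i))
            }
          ; assoc = λ x y z i → ≡⇒ i (ℤ.+-assoc (x i) (y i) (z i))
          }
        ; identity = (λ x i → ≡⇒ i (ℤ.+-identityˡ (x i))) , (λ x i → ≡⇒ i (ℤ.+-identityʳ (x i)))
        }
      ; inverse = (λ x i → ≡⇒ i (ℤ.+-inverseˡ (x i))) , (λ x i → ≡⇒ i (ℤ.+-inverseʳ (x i)))
      ; ⁻¹-cong = λ {x} {y} p i → subst (+ q i ℤ∣.∣_) (neg (x i) (y i)) (ℤ∣.∣m⇒∣-m (p i))
      }
    ; comm = λ x y i → ≡⇒ i (ℤ.+-comm (x i) (y i))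
    }
  }
  where
  ≡⇒ : ∀ i {a b} → a ≡ b → + q i ℤ∣.∣ a ℤ.- b
  ≡⇒ i {a} ≡.refl = subst (+ q i ℤ∣.∣_) (≡.sym (ℤ.+-inverseʳ a)) (divides 0ℤ ≡.refl)

  flip : ∀ a b → ℤ.- (a ℤ.- b) ≡ b ℤ.- a
  flip = solve-∀

  chain : ∀ a b c → (a ℤ.- b) ℤ.+ (b ℤ.- c) ≡ a ℤ.- c
  chain = solve-∀

  plus : ∀ a b c e → (a ℤ.- b) ℤ.+ (c ℤ.- e) ≡ (a ℤ.+ c) ℤ.- (b ℤ.+ e)
  plus = solve-∀

  neg : ∀ a b → ℤ.- (a ℤ.- b) ≡ (ℤ.- a) ℤ.- (ℤ.- b)
  neg = solve-∀

∏ : ∀ {d} → Vector ℕ d → ℕ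
∏ = foldr ℕ._*_ 1

private
  residue-unique≤ : ∀ {q r s} → r ℕ.≤ s → s ℕ.< q → + q ℤ∣.∣ + r ℤ.- + s → r ≡ s
  residue-unique≤ {q} {r} {s} r≤s s<q q∣ = ℕ.≤-antisym r≤s (ℕ.m∸n≡0⇒m≤n (small _
    (ℕ.≤-<-trans (ℕ.m∸n≤m s r) s<q)
    (subst (q ℕ∣.∣_) (≡.trans (cong ℤ.∣_∣ (ℤ.m-n≡m⊖n r s)) (ℤ.∣⊖∣-≤ r≤s)) (ℤ∣.∣⇒∣ᵤ q∣))))
    where
    small : ∀ t → t ℕ.< q → q ℕ∣.∣ t → t ≡ 0
    small zero    t<q q∣t = ≡.refl
    small (suc t) t<q q∣t = contradiction q∣t (ℕ∣.>⇒∤ t<q)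

  residue-unique : ∀ {q r s} → r ℕ.< q → s ℕ.< q → + q ℤ∣.∣ + r ℤ.- + s → r ≡ s
  residue-unique {q} {r} {s} r<q s<q q∣ with ℕ.≤-total r s
  ... | inj₁ r≤s = residue-unique≤ r≤s s<q q∣
  ... | inj₂ s≤r = ≡.sym (residue-unique≤ s≤r r<q
    (subst (+ q ℤ∣.∣_) (flip (+ r) (+ s)) (ℤ∣.∣m⇒∣-m q∣)))
    where
    flip : ∀ a b → ℤ.- (a ℤ.- b) ≡ b ℤ.- a
    flip = solve-∀

  residue : ∀ q .{{_ : NonZero q}} → ℤ → Fin q
  residue q a = fromℕ< (ℤ.n%ℕd<d a q)

  residue-∣ : ∀ q .{{_ : NonZero q}} a → + q ℤ∣.∣ + toℕ (residue q a) ℤ.- a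
  residue-∣ q a = divides (ℤ.- (a ℤ./ℕ q)) (begin
    + toℕ (residue q a) ℤ.- a ≡⟨ cong (λ r → + r ℤ.- a) (Fin.toℕ-fromℕ< _) ⟩
    + (a ℤ.%ℕ q) ℤ.- a
      ≡⟨ cong (λ b → + (a ℤ.%ℕ q) ℤ.- b) (ℤ.a≡a%ℕn+[a/ℕn]*n a q) ⟩
    + (a ℤ.%ℕ q) ℤ.- (+ (a ℤ.%ℕ q) ℤ.+ (a ℤ./ℕ q) ℤ.* + q)
      ≡⟨ lemma (+ (a ℤ.%ℕ q)) (a ℤ./ℕ q) (+ q) ⟩
    ℤ.- (a ℤ./ℕ q) ℤ.* + q    ∎)
    where
    lemma : ∀ r t q → r ℤ.- (r ℤ.+ t ℤ.* q) ≡ ℤ.- t ℤ.* q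
    lemma = solve-∀

  cyclicSum-to : ∀ {d} (q : Fin d → ℕ) → Fin (∏ q) → Vector ℤ d
  cyclicSum-to {suc d} q x zero    = + toℕ (proj₁ (Fin.remQuot {q zero} (∏ (q ∘ suc)) x))
  cyclicSum-to {suc d} q x (suc i) =
    cyclicSum-to (q ∘ suc) (proj₂ (Fin.remQuot {q zero} (∏ (q ∘ suc)) x)) i

  cyclicSum-from : ∀ {d} (q : Fin d → ℕ) → (∀ i → NonZero (q i)) → Vector ℤ d → Fin (∏ q)
  cyclicSum-from {zero}  q nz x = zero
  cyclicSum-from {suc d} q nz x = Fin.combine
    (residue (q zero) {{nz zero}} (x zero))
    (cyclicSum-from (q ∘ suc) (nz ∘ suc) (x ∘ suc))

  cyclicSum-to-from : ∀ {d} (q : Fin d → ℕ) nz x i →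
    + q i ℤ∣.∣ cyclicSum-to q (cyclicSum-from q nz x) i ℤ.- x i
  cyclicSum-to-from {suc d} q nz x zero = subst (λ r → + q zero ℤ∣.∣ + toℕ (proj₁ r) ℤ.- x zero)
    (≡.sym (Fin.remQuot-combine (residue (q zero) {{nz zero}} (x zero))
              (cyclicSum-from (q ∘ suc) (nz ∘ suc) (x ∘ suc))))
    (residue-∣ (q zero) {{nz zero}} (x zero))
  cyclicSum-to-from {suc d} q nz x (suc i) = subst
    (λ r → + q (suc i) ℤ∣.∣ cyclicSum-to (q ∘ suc) (proj₂ r) i ℤ.- x (suc i))
    (≡.sym (Fin.remQuot-combine (residue (q zero) {{nz zero}} (x zero))
              (cyclicSum-from (q ∘ suc) (nz ∘ suc) (x ∘ suc))))
    (cyclicSum-to-from (q ∘ suc) (nz ∘ suc) (x ∘ suc) i)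

  cyclicSum-to-injective : ∀ {d} (q : Fin d → ℕ) {x y} →
    (∀ i → + q i ℤ∣.∣ cyclicSum-to q x i ℤ.- cyclicSum-to q y i) → x ≡ y
  cyclicSum-to-injective {zero} q {zero} {zero} eq = ≡.refl
  cyclicSum-to-injective {suc d} q {x} {y} eq = begin
    x                       ≡⟨ Fin.combine-remQuot {q zero} (∏ (q ∘ suc)) x ⟨
    Fin.combine (proj₁ rx) (proj₂ rx)
      ≡⟨ cong₂ Fin.combine
           (Fin.toℕ-injective (residue-unique (Fin.toℕ<n (proj₁ rx)) (Fin.toℕ<n (proj₁ ry)) (eq zero)))
           (cyclicSum-to-injective (q ∘ suc) (eq ∘ suc)) ⟩
    Fin.combine (proj₁ ry) (proj₂ ry)
                            ≡⟨ Fin.combine-remQuot {q zero} (∏ (q ∘ suc)) y ⟩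
    y                       ∎
    where
    rx = Fin.remQuot {q zero} (∏ (q ∘ suc)) x
    ry = Fin.remQuot {q zero} (∏ (q ∘ suc)) y

cyclicSum-enumeration : ∀ {d} (q : Fin d → ℕ) → (∀ i → NonZero (q i)) →
  Inverse (≡.setoid (Fin (∏ q))) (AbelianGroup.setoid (cyclicSum q))
cyclicSum-enumeration q nz = record
  { to        = to
  ; from      = from
  ; to-cong   = λ { {x} ≡.refl → G.refl {to x} }
  ; from-cong = λ {x} {y} x≈y → cyclicSum-to-injective q
      (G.trans {to (from x)} {x} {to (from y)} (to-from x)
        (G.trans {x} {y} {to (from y)} x≈y (G.sym {to (from y)} {y} (to-from y))))
  ; inverse   = (λ { {x} ≡.refl → to-from x })
              , (λ {i} {x} x≈ → cyclicSum-to-injective q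
                  (G.trans {to (from x)} {x} {to i} (to-from x) x≈))
  }
  where
  module G = AbelianGroup (cyclicSum q)
  to      = cyclicSum-to q
  from    = cyclicSum-from q nz
  to-from = cyclicSum-to-from q nz

module _ {d} (q : Fin d → ℕ) where
  private
    module G = AbelianGroup (cyclicSum q)
    open Combinations (cyclicSum q)

    ×-pointwise : ∀ n (x : Vector ℤ d) i →
      MonoidMult._×_ G.commutativeMonoid n x i ≡ + n ℤ.* x i
    ×-pointwise zero    x i = ≡.refl
    ×-pointwise (suc n) x i =
      ≡.trans (cong (ℤ._+_ (x i)) (×-pointwise n x i)) (lemma (x i) (+ n))
      where
      lemma : ∀ a n → a ℤ.+ n ℤ.* a ≡ (1ℤ ℤ.+ n) ℤ.* a
      lemma = solve-∀

    ·-pointwise : ∀ a (x : Vector ℤ d) i → (a · x) i ≡ a ℤ.* x i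
    ·-pointwise (+ n)    x i = ×-pointwise n x i
    ·-pointwise -[1+ n ] x i =
      ≡.trans (cong ℤ.-_ (×-pointwise (suc n) x i)) (ℤ.neg-distribˡ-* (+ suc n) (x i))

  combination-pointwise : ∀ {m} (a : Vector ℤ m) (g : Fin m → Vector ℤ d) i →
    combination a g i ≡ ℤΣ.sum (λ j → g j i ℤ.* a j)
  combination-pointwise {zero}  a g i = ≡.refl
  combination-pointwise {suc m} a g i = cong₂ ℤ._+_
    (≡.trans (·-pointwise (a zero) (g zero) i) (ℤ.*-comm (a zero) (g zero i)))
    (combination-pointwise (a ∘ suc) (g ∘ suc) i)

column : ∀ {d} → Matrix d → Fin d → Vector ℤ d
column A j i = A i j

-- Cay(ℤ/q₁ ⊕ ⋯ ⊕ ℤ/q_d, {U e₁, …, U e_d})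
cyclicSumDigraph : ∀ {d} (q : Fin d → ℕ) → (∀ i → NonZero (q i)) →
  (U : Matrix d) → Unimodular U →
  let open AbelianGroup (cyclicSum q) in
  (∀ {j k} → column U j ≈ column U k → j ≡ k) → (∀ j → ¬ column U j ≈ ε) →
  CayleyDigraph d
cyclicSumDigraph q nz U (U⁻¹ , UU⁻¹≐1 , _) injective nonzero = record
  { abelianGroup  = cyclicSum q
  ; ord           = ∏ q
  ; enumeration   = cyclicSum-enumeration q nz
  ; gen           = column U
  ; gen-injective = injective
  ; gen≉ε         = nonzero
  ; gen-generates = λ x → U⁻¹ *ᵥ x , λ i → subst (+ q i ℤ∣.∣_)
      (≡.sym (ℤ.i≡j⇒i-j≡0 (≡.trans (combination-pointwise q (U⁻¹ *ᵥ x) (column U) i)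
                                     (cancelˡ U U⁻¹ UU⁻¹≐1 x i))))
      (divides 0ℤ ≡.refl)
  }

-- The columns of M form a basis of the lattice of relations {a ∣ ∑ᵢ aᵢ gᵢ = 0}.
record IsKernelBasis {d} (Γ : CayleyDigraph d) (M : Matrix d) : Set where
  open CayleyDigraph Γ
  field
    spans       : ∀ a → combination a gen ≈ ε ⇔ ∃ λ c → ∀ i → a i ≡ (M *ᵥ c) i
    independent : ∀ c → (∀ i → (M *ᵥ c) i ≡ 0ℤ) → ∀ i → c i ≡ 0ℤ

record SmithDecomposition {d} (M : Matrix d) : Set where
  field
    U V            : Matrix d
    U-unimodular   : Unimodular U
    V-unimodular   : Unimodular V
    s              : Fin d → ℕ
    diagonal≐U⊠M⊠V : diagonal s ≐ U ⊠ M ⊠ V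
    s-divides      : ∀ i j → toℕ j ≡ suc (toℕ i) → s i ℕ∣.∣ s j

module Dilation {d} (Γ : CayleyDigraph d) {M : Matrix d}
                (basis : IsKernelBasis Γ M) (smith : SmithDecomposition M) where
  private
    open CayleyDigraph Γ hiding (_≈_; identity)
    module Γ = CayleyDigraph Γ
    open IsKernelBasis basis
    open SmithDecomposition smith
    U⁻¹ = proj₁ U-unimodular
    V⁻¹ = proj₁ V-unimodular

  e : Fin d → Vector ℤ d
  e j i = identity i j

  UMV-*ᵥ : ∀ x i → (U *ᵥ (M *ᵥ (V *ᵥ x))) i ≡ + s i ℤ.* x i
  UMV-*ᵥ x i = begin
    (U *ᵥ (M *ᵥ (V *ᵥ x))) i ≡⟨ ⊠-*ᵥ U M (V *ᵥ x) i ⟨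
    (U ⊠ M *ᵥ (V *ᵥ x)) i    ≡⟨ ⊠-*ᵥ (U ⊠ M) V x i ⟨
    (U ⊠ M ⊠ V *ᵥ x) i       ≡⟨ *ᵥ-cong diagonal≐U⊠M⊠V (λ _ → ≡.refl) i ⟨
    (diagonal s *ᵥ x) i      ≡⟨ diagonal-*ᵥ s x i ⟩
    + s i ℤ.* x i            ∎

  U-injective : ∀ x y → (∀ i → (U *ᵥ x) i ≡ (U *ᵥ y) i) → ∀ i → x i ≡ y i
  U-injective x y eq i = begin
    x i                  ≡⟨ cancelˡ U⁻¹ U (proj₂ (proj₂ U-unimodular)) x i ⟨
    (U⁻¹ *ᵥ (U *ᵥ x)) i  ≡⟨ *ᵥ-congʳ U⁻¹ eq i ⟩
    (U⁻¹ *ᵥ (U *ᵥ y)) i  ≡⟨ cancelˡ U⁻¹ U (proj₂ (proj₂ U-unimodular)) y i ⟩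
    y i                  ∎

  e-diagonal : ∀ {d} (i : Fin d) → identity i i ≡ 1ℤ
  e-diagonal zero    = ≡.refl
  e-diagonal (suc i) = e-diagonal i

  s*e≡0 : ∀ i → s i ≡ 0 → ∀ j → + s j ℤ.* e i j ≡ 0ℤ
  s*e≡0 i si≡0 j = begin
    + s j ℤ.* e i j       ≡⟨ off i j ⟩
    + s i ℤ.* e i j       ≡⟨ cong (λ k → + k ℤ.* e i j) si≡0 ⟩
    0ℤ ℤ.* e i j          ∎
    where
    off : ∀ i j → + s j ℤ.* e i j ≡ + s i ℤ.* e i j
    off i j with i Fin.≟ j
    ... | yes ≡.refl = ≡.refl
    ... | no i≢j = ≡.trans (cong (+ s j ℤ.*_) (off-diagonal j i (i≢j ∘ ≡.sym)))
        (≡.trans (ℤ.*-zeroʳ (+ s j)) (≡.sym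
          (≡.trans (cong (+ s i ℤ.*_) (off-diagonal j i (i≢j ∘ ≡.sym))) (ℤ.*-zeroʳ (+ s i)))))
      where
      off-diagonal : ∀ {d} (i j : Fin d) → i ≢ j → identity i j ≡ 0ℤ
      off-diagonal zero    zero    i≢j = contradiction ≡.refl i≢j
      off-diagonal zero    (suc j) i≢j = ≡.refl
      off-diagonal (suc i) zero    i≢j = ≡.refl
      off-diagonal (suc i) (suc j) i≢j = off-diagonal i j (i≢j ∘ cong suc)

  s≢0 : ∀ i → s i ≢ 0
  s≢0 i si≡0 = contradiction (≡.trans (≡.sym (e-diagonal i)) (e≡0 i)) λ ()
    where
    Ve≡0 : ∀ j → (V *ᵥ e i) j ≡ 0ℤ
    Ve≡0 = independent (V *ᵥ e i) (U-injective _ (λ _ → 0ℤ) λ j →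
      ≡.trans (UMV-*ᵥ (e i) j) (≡.trans (s*e≡0 i si≡0 j) (≡.sym (*ᵥ-0 U (λ _ → ≡.refl) j))))
    e≡0 : ∀ j → e i j ≡ 0ℤ
    e≡0 j = ≡.trans (≡.sym (cancelˡ V⁻¹ V (proj₂ (proj₂ V-unimodular)) (e i) j)) (*ᵥ-0 V⁻¹ Ve≡0 j)

  module _ (m : ℕ) where
    q : Fin d → ℕ
    q i = m ℕ.* s i

    kernel : ∀ a → (∀ i → + q i ℤ∣.∣ (U *ᵥ a) i) → combination a gen Γ.≈ ε
    kernel a q∣Ua = Equivalence.from (spans a) (V *ᵥ y , U-injective a (M *ᵥ (V *ᵥ y)) λ i → begin
      (U *ᵥ a) i                          ≡⟨ ℤ∣._∣_.equality (q∣Ua i) ⟩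
      ℤ∣.quotient (q∣Ua i) ℤ.* + (m ℕ.* s i)
        ≡⟨ cong (ℤ∣.quotient (q∣Ua i) ℤ.*_) (ℤ.pos-* m (s i)) ⟩
      ℤ∣.quotient (q∣Ua i) ℤ.* (+ m ℤ.* + s i)
        ≡⟨ lemma (ℤ∣.quotient (q∣Ua i)) (+ m) (+ s i) ⟩
      + s i ℤ.* y i                       ≡⟨ UMV-*ᵥ y i ⟨
      (U *ᵥ (M *ᵥ (V *ᵥ y))) i            ∎)
      where
      y : Vector ℤ d
      y i = + m ℤ.* ℤ∣.quotient (q∣Ua i)
      lemma : ∀ t m s → t ℤ.* (m ℤ.* s) ≡ s ℤ.* (m ℤ.* t)
      lemma = solve-∀

    combination-e : ∀ j → combination (e j) gen Γ.≈ gen j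
    combination-e j = go j gen
      where
      zeros : ∀ {k} (g : Vector Carrier k) → combination (λ _ → 0ℤ) g Γ.≈ ε
      zeros {zero}  g = Γ.refl
      zeros {suc k} g = Γ.trans (Γ.identityˡ _) (zeros (g ∘ suc))
      go : ∀ {k} (j : Fin k) (g : Vector Carrier k) → combination (λ i → identity i j) g Γ.≈ g j
      go zero g = Γ.trans (Γ.∙-cong (Γ.identityʳ _) (zeros (g ∘ suc))) (Γ.identityʳ _)
      go (suc j) g = Γ.trans (Γ.identityˡ _) (go j (g ∘ suc))

    columns-injective : ∀ {j k} → (∀ i → + q i ℤ∣.∣ U i j ℤ.- U i k) → j ≡ k
    columns-injective {j} {k} q∣ = gen-injective (Γ.trans
      (x∙y⁻¹≈ε⇒x≈y _ _ (Γ.trans (Γ.∙-cong (Γ.sym (combination-e j)) (Γ.⁻¹-cong (Γ.sym (combination-e k))))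
        (Γ.trans (Γ.∙-congˡ (Γ.sym (combination-neg (e k) gen)))
        (Γ.trans (Γ.sym (combination-homo-+ (e j) (λ i → ℤ.- e k i) gen))
          (kernel _ λ i → subst (+ q i ℤ∣.∣_) (≡.sym (Ue-e i)) (q∣ i)))))) Γ.refl)
      where
      open AbelianGroupProperties abelianGroup
      Ue-e : ∀ i → (U *ᵥ λ i → e j i ℤ.- e k i) i ≡ U i j ℤ.- U i k
      Ue-e i = ≡.trans (*ᵥ-+ U (e j) (λ i → ℤ.- e k i) i)
        (cong₂ ℤ._+_ (*ᵥ-identity U j i)
          (≡.trans (*ᵥ-neg U (e k) i) (cong ℤ.-_ (*ᵥ-identity U k i))))

    columns-nonzero : ∀ j → ¬ (∀ i → + q i ℤ∣.∣ U i j ℤ.- 0ℤ)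
    columns-nonzero j q∣ = gen≉ε j (Γ.trans (Γ.sym (combination-e j))
      (kernel (e j) λ i → subst (+ q i ℤ∣.∣_)
        (≡.trans (ℤ.+-identityʳ _) (≡.sym (*ᵥ-identity U j i))) (q∣ i)))

  -- mΓ = Cay(ℤ/ms₁ ⊕ ⋯ ⊕ ℤ/ms_d, {U e₁, …, U e_d})
  dilate : (m : ℕ) .{{_ : NonZero m}} → CayleyDigraph d
  dilate m = cyclicSumDigraph (λ i → m ℕ.* s i)
    (λ i → ℕ.m*n≢0 m (s i) {{it}} {{ℕ.≢-nonZero (s≢0 i)}})
    U U-unimodular (columns-injective m) (columns-nonzero m)

open Dilation public using (dilate)

private
  -- Cay((ℤ/2)ᵈ, {e₁, …, e_d})
  hypercube : ∀ d → CayleyDigraph d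
  hypercube d = cyclicSumDigraph (λ _ → 2) (λ _ → it) identity identity-unimodular
    (λ {j} {k} → injective j k) nonzero
    where
    2∤1 : ¬ + 2 ℤ∣.∣ 1ℤ
    2∤1 2∣1 with ℤ∣.∣⇒∣ᵤ 2∣1
    ... | ℕ∣.divides zero ()
    ... | ℕ∣.divides (suc _) ()

    injective : ∀ {d} (j k : Fin d) →
      (∀ i → + 2 ℤ∣.∣ identity i j ℤ.- identity i k) → j ≡ k
    injective zero    zero    eq = ≡.refl
    injective zero    (suc k) eq = contradiction (eq zero) 2∤1
    injective (suc j) zero    eq = contradiction (subst (+ 2 ℤ∣.∣_) ≡.refl (ℤ∣.∣m⇒∣-m (eq zero))) 2∤1
    injective (suc j) (suc k) eq = cong suc (injective j k (eq ∘ suc))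

    nonzero : ∀ {d} (j : Fin d) → ¬ (∀ i → + 2 ℤ∣.∣ identity i j ℤ.- 0ℤ)
    nonzero zero    eq = 2∤1 (eq zero)
    nonzero (suc j) eq = nonzero j (eq ∘ suc)

module Tightness (ℝ : CompleteOrderedField) where
  open Reals ℝ public
  open RealsProperties ℝ public using (isNatural?; fromℕ-/-≤1)
  open RealFunctions ℝ public
  open CayleyDigraph using (ord; diameter)

  solidDensity : ∀ {d} → CayleyDigraph d → Carrier
  solidDensity {d} Γ = fromℕ (ord Γ) / fromℕ ((diameter Γ ℕ.+ d) ℕ.^ d)

  SolidDensities : ℕ → Pred Carrier (lsuc 0ℓ)
  SolidDensities d x = ∃ λ (Γ : CayleyDigraph d) → x ≈ solidDensity Γ

  abstract
    solidDensity-supremum : ∀ d .{{_ : NonZero d}} → ∃ (IsSupremum (SolidDensities d))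
    solidDensity-supremum d = supremum (SolidDensities d)
      (solidDensity (hypercube d) , hypercube d , refl)
      (1# , λ x (Γ , x≈δ) → ≤-respˡ-≈ (sym x≈δ) (fromℕ-/-≤1
        (ℕ.≤-trans (CayleyDigraph.ord≤[1+diameter]^d Γ)
          (ℕ.^-monoˡ-≤ d (1+k≤k+d (diameter Γ))))
        ([k+d]^d≢0 (diameter Γ))))
      where
      open IsDecTotalOrder isDecTotalOrder using (≤-respˡ-≈)
      1+k≤k+d : ∀ k → suc k ℕ.≤ k ℕ.+ d
      1+k≤k+d k = subst (ℕ._≤ k ℕ.+ d) (ℕ.+-comm k 1) (ℕ.+-monoʳ-≤ k (ℕ.>-nonZero⁻¹ d))
      [k+d]^d≢0 : ∀ k → (k ℕ.+ d) ℕ.^ d ≢ 0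
      [k+d]^d≢0 k eq with () ← subst (suc k ℕ.≤_) (ℕ.m^n≡0⇒m≡0 (k ℕ.+ d) d eq) (1+k≤k+d k)

  Δ : (d : ℕ) .{{_ : NonZero d}} → Carrier
  Δ d = proj₁ (solidDensity-supremum d)

  module _ (d : ℕ) .{{_ : NonZero d}} where
    scaledRoot : ℕ → Carrier
    scaledRoot n = root d (fromℕ n / Δ d)

    ℓ : ℕ → ℤ
    ℓ n = ⌈ scaledRoot n ⌉ ℤ.- + d

    C : Pred Carrier 0ℓ
    C x = IsNatural (Δ d * x ^ d)

    β : ℕ → Carrier
    β n = 1# / ⟦ scaledRoot n ⟧

    c : ℕ → Carrier
    c n with isNatural? (β n)
    ... | yes _ = β n - 1#
    ... | no  _ = fromℤ ⌊ β n ⌋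

  tightness : ∀ {d} .{{_ : NonZero d}} → CayleyDigraph d → ℤ
  tightness {d} Γ = + diameter Γ ℤ.- ℓ d (ord Γ)

  Tight : ∀ {d} .{{_ : NonZero d}} → CayleyDigraph d → Set
  Tight Γ = tightness Γ ≡ 0ℤ

{-# OPTIONS --safe #-}
module Submission where

-- Let L be the lattice of relations between the generators, so that mΓ has
-- lattice mL.  Writing z = m w + r with 0 ≤ rᵢ < m, a nonnegative representative
-- b of w mod L gives the representative m b + r of z mod mL, and for
-- r = (m - 1, …, m - 1) all nonnegative representatives arise so.  Hence
-- k(mΓ) + d = m (k(Γ) + d), while |mΓ| = mᵈ |Γ| scales the root by m.
-- With ρ = (n/Δ_d)^(1/d), tightness of Γ says ⌈ρ⌉ = k(Γ) + d, so mΓ is tight iff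
-- ⌈mρ⌉ = m ⌈ρ⌉, i.e. m (⌈ρ⌉ - ρ) < 1, i.e. m < β.  The hypothesis on n says that ρ
-- is not an integer, so β is not a division by 0.

open import Defs
open import Algebra.Bundles using (AbelianGroup)
import Algebra.Properties.AbelianGroup as AbelianGroupProperties
import Algebra.Properties.CommutativeMonoid.Mult as MonoidMult
import Algebra.Properties.CommutativeSemiring.Exp as Exp
import Algebra.Properties.Ring as RingProperties
import Algebra.Properties.Semiring.Mult as SemiringMult
import Algebra.Properties.Semiring.Sum as SemiringSum
open import Data.Fin.Base using (Fin; zero; suc)
import Data.Fin.Properties as Fin
open import Data.Integer.Base as ℤ using (ℤ; +_; -[1+_]; 0ℤ; 1ℤ)
import Data.Integer.DivMod as ℤ
open import Data.Integer.Divisibility.Signed as ℤ∣ using (divides)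
import Data.Integer.Properties as ℤ
open import Data.Integer.Tactic.RingSolver using (solve-∀)
open import Data.Nat.Base as ℕ using (ℕ; zero; suc; NonZero)
import Data.Nat.Properties as ℕ
import Data.Nat.Tactic.RingSolver as ℕ-Solver
open import Data.Product.Base using (∃; _×_; _,_; proj₁; proj₂)
open import Data.Sum.Base using (inj₁; inj₂)
open import Data.Vec.Functional using (Vector; updateAt)
open import Function.Base using (_∘_; id)
open import Function.Bundles using (Inverse; _⇔_; mk⇔; Equivalence)
open import Level using (0ℓ)
open import Relation.Binary.Bundles using (Poset)
open import Relation.Binary.PropositionalEquality as ≡ using (_≡_; cong; cong₂; subst)
open import Relation.Binary.Structures using (IsDecTotalOrder)
open import Relation.Nullary.Decidable using (yes; no)
open import Relation.Nullary.Negation using (¬_; contradiction)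
open import Relation.Unary using (Pred; _∈_)

-- Sums and maxima of vectors, and division with remainder.

module ℕΣ = SemiringSum ℕ.+-*-semiring

-- The `Fin n` argument excludes the empty vector, whose maximum 0 is attained nowhere.
maximum-attained : ∀ {n} (f : Vector ℕ n) → Fin n → ∃ λ i → f i ≡ maximum f
maximum-attained {suc zero}    f _ = zero , ≡.sym (ℕ.⊔-identityʳ (f zero))
maximum-attained {suc (suc n)} f _
  with i , eq ← maximum-attained (f ∘ suc) zero
  with ℕ.⊔-sel (f zero) (maximum (f ∘ suc))
... | inj₁ sel = zero , ≡.sym sel
... | inj₂ sel = suc i , ≡.trans eq (≡.sym sel)

sum-updateAt-suc : ∀ {n} (a : Vector ℕ n) i → ℕΣ.sum (updateAt a i suc) ≡ suc (ℕΣ.sum a)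
sum-updateAt-suc {suc n} a zero    = ≡.refl
sum-updateAt-suc {suc n} a (suc i) =
  ≡.trans (cong (a zero ℕ.+_) (sum-updateAt-suc (a ∘ suc) i)) (ℕ.+-suc (a zero) _)

sum-*-+ : ∀ m {n} (b r : Vector ℕ n) →
  ℕΣ.sum (λ i → m ℕ.* b i ℕ.+ r i) ≡ m ℕ.* ℕΣ.sum b ℕ.+ ℕΣ.sum r
sum-*-+ m b r = ≡.trans (ℕΣ.∑-distrib-+ (λ i → m ℕ.* b i) r)
  (cong (ℕ._+ ℕΣ.sum r) (≡.sym (ℕΣ.*-distribˡ-sum m b)))

sum-mono-≤ : ∀ {n} {f g : Vector ℕ n} → (∀ i → f i ℕ.≤ g i) → ℕΣ.sum f ℕ.≤ ℕΣ.sum g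
sum-mono-≤ {zero}  f≤g = ℕ.z≤n
sum-mono-≤ {suc n} f≤g = ℕ.+-mono-≤ (f≤g zero) (sum-mono-≤ (f≤g ∘ suc))

sum-const : ∀ n k → ℕΣ.sum {n} (λ _ → k) ≡ n ℕ.* k
sum-const zero    k = ≡.refl
sum-const (suc n) k = cong (k ℕ.+_) (sum-const n k)

module _ (m : ℕ) .{{_ : NonZero m}} where
  open ≡.≡-Reasoning

  m≡1+pred : + m ≡ 1ℤ ℤ.+ + ℕ.pred m
  m≡1+pred = cong +_ (≡.sym (ℕ.suc-pred m))

  -- If w is at most -1, then m w + (m - 1) is at most -1 and cannot be the natural number `a`. The
  -- remainder m - 1 is the largest for which this works, which is what makes the lower bound on the
  -- diameter match the upper one.
  quotient-nonneg : ∀ a w → + a ≡ + m ℤ.* w ℤ.+ + ℕ.pred m →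
    ∃ λ b → w ≡ + b × a ≡ m ℕ.* b ℕ.+ ℕ.pred m
  quotient-nonneg a (+ b) eq = b , ≡.refl , ℤ.+-injective
    (≡.trans eq (cong (ℤ._+ + ℕ.pred m) (≡.sym (ℤ.pos-* m b))))
  quotient-nonneg a -[1+ b ] eq = contradiction (≡.trans eq negative) λ ()
    where
    -- With p = m - 1, the right side is -(1 + m b), which is the constructor form `-[1+ m ℕ.* b ]`
    -- and so clashes with `+ a`.
    lemma : ∀ p b → (1ℤ ℤ.+ p) ℤ.* ℤ.- (1ℤ ℤ.+ b) ℤ.+ p ≡ ℤ.- (1ℤ ℤ.+ (1ℤ ℤ.+ p) ℤ.* b)
    lemma = solve-∀
    negative : + m ℤ.* -[1+ b ] ℤ.+ + ℕ.pred m ≡ -[1+ m ℕ.* b ]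
    negative = begin
      + m ℤ.* -[1+ b ] ℤ.+ + ℕ.pred m
        ≡⟨ cong (λ k → k ℤ.* -[1+ b ] ℤ.+ + ℕ.pred m) m≡1+pred ⟩
      (1ℤ ℤ.+ + ℕ.pred m) ℤ.* ℤ.- (1ℤ ℤ.+ + b) ℤ.+ + ℕ.pred m
        ≡⟨ lemma (+ ℕ.pred m) (+ b) ⟩
      ℤ.- (1ℤ ℤ.+ (1ℤ ℤ.+ + ℕ.pred m) ℤ.* + b)
        ≡⟨ cong (λ k → ℤ.- (1ℤ ℤ.+ k ℤ.* + b)) m≡1+pred ⟨
      ℤ.- (1ℤ ℤ.+ + m ℤ.* + b)
        ≡⟨ cong (λ k → ℤ.- (1ℤ ℤ.+ k)) (ℤ.pos-* m b) ⟨
      -[1+ m ℕ.* b ] ∎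

-- Walks, integer combinations and the diameter in terms of the relation lattice.

module _ {c ℓ} (A : AbelianGroup c ℓ) where
  open AbelianGroup A
  open Combinations A
  open import Algebra.Properties.CommutativeSemigroup commutativeSemigroup using (x∙yz≈y∙xz)

  combination-zero : ∀ {n} (g : Vector Carrier n) → combination (λ _ → 0ℤ) g ≈ ε
  combination-zero {zero}  g = refl
  combination-zero {suc n} g = trans (identityˡ _) (combination-zero (g ∘ suc))

  combination-updateAt-suc : ∀ {n} (a : Vector ℕ n) i (g : Vector Carrier n) →
    combination (+_ ∘ updateAt a i suc) g ≈ g i ∙ combination (+_ ∘ a) g
  combination-updateAt-suc {suc n} a zero    g = assoc _ _ _
  combination-updateAt-suc {suc n} a (suc i) g = trans
    (∙-congˡ (combination-updateAt-suc (a ∘ suc) i (g ∘ suc))) (x∙yz≈y∙xz _ _ _)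

module _ {d} (Γ : CayleyDigraph d) where
  open CayleyDigraph Γ
  open AbelianGroupProperties abelianGroup
  open MonoidMult commutativeMonoid using () renaming (_×_ to _×ℕ_)
  open import Relation.Binary.Reasoning.Setoid setoid

  -- The lattice L lives in the free group of rank d, so digraphs on different groups can be
  -- compared through it.
  Kernel : Pred (Vector ℤ d) 0ℓ
  Kernel a = combination a gen ≈ ε

  Kernel-resp : ∀ {a b} → (∀ i → a i ≡ b i) → Kernel a → Kernel b
  Kernel-resp a≡b = trans (sym (combination-cong gen a≡b))

  combination-sub : ∀ (a b : Vector ℤ d) →
    combination (λ i → a i ℤ.- b i) gen ≈ combination a gen ∙ combination b gen ⁻¹
  combination-sub a b = trans (combination-homo-+ a (ℤ.-_ ∘ b) gen) (∙-congˡ (combination-neg b gen))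

  Kernel-sub : ∀ a b → Kernel (λ i → a i ℤ.- b i) ⇔ combination a gen ≈ combination b gen
  Kernel-sub a b = mk⇔
    (λ k → x∙y⁻¹≈ε⇒x≈y _ _ (trans (sym (combination-sub a b)) k))
    (λ eq → trans (combination-sub a b) (x≈y⇒x∙y⁻¹≈ε eq))

  -- The group is commutative, so a walk matters only through how often it uses each generator.
  -- Unlike the coordinatewise bound of `steps`, the exact total is kept, since the length of the
  -- walk has to be recovered from it.
  walk⇒combination : ∀ l {u v} → Walk l u v →
    ∃ λ (a : Vector ℕ d) → ℕΣ.sum a ≡ l × v ≈ u ∙ combination (+_ ∘ a) gen
  walk⇒combination zero {u} {v} u≈v = (λ _ → 0) , ℕΣ.sum-replicate-zero d , (begin
    v                              ≈⟨ u≈v ⟨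
    u                              ≈⟨ identityʳ u ⟨
    u ∙ ε                          ≈⟨ ∙-congˡ (combination-zero abelianGroup gen) ⟨
    u ∙ combination (λ _ → 0ℤ) gen ∎)
  walk⇒combination (suc l) {u} {v} (w , (i , w≈) , walk)
    with a , eq , v≈ ← walk⇒combination l walk =
    updateAt a i suc , ≡.trans (sum-updateAt-suc a i) (cong suc eq) , (begin
      v                                           ≈⟨ v≈ ⟩
      w ∙ combination (+_ ∘ a) gen                ≈⟨ ∙-congʳ w≈ ⟩
      u ∙ gen i ∙ combination (+_ ∘ a) gen        ≈⟨ assoc _ _ _ ⟩
      u ∙ (gen i ∙ combination (+_ ∘ a) gen)      ≈⟨ ∙-congˡ (combination-updateAt-suc abelianGroup a i gen) ⟨
      u ∙ combination (+_ ∘ updateAt a i suc) gen ∎)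

  walk-× : ∀ n i u → Walk n u (u ∙ n ×ℕ gen i)
  walk-× zero    i u = sym (identityʳ u)
  walk-× (suc n) i u = u ∙ gen i , (i , refl) ,
    walk-respʳ n (assoc _ _ _) (walk-× n i (u ∙ gen i))

  -- The walk spends the generators one after another. The reindexing `ι` allows induction on the
  -- number of generators left while the digraph, and with it `d`, stays fixed.
  combination⇒walk : ∀ {n} (ι : Fin n → Fin d) (a : Vector ℕ n) u →
    Walk (ℕΣ.sum a) u (u ∙ combination (+_ ∘ a) (gen ∘ ι))
  combination⇒walk {zero}  ι a u = sym (identityʳ u)
  combination⇒walk {suc n} ι a u = walk-respʳ (a zero ℕ.+ ℕΣ.sum (a ∘ suc)) (assoc _ _ _)
    (walk-++ (a zero) (walk-× (a zero) (ι zero) u)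
      (combination⇒walk (ι ∘ suc) (a ∘ suc) (u ∙ a zero ×ℕ gen (ι zero))))

  -- Together with `diameter-attained` this describes the diameter by L alone: it is the least k
  -- such that every class modulo L has a nonnegative representative with coordinate sum at most k.
  -- A shortest walk from `ε` provides the representative.
  diameter-covers : ∀ z → ∃ λ (a : Vector ℕ d) →
    ℕΣ.sum a ℕ.≤ diameter × Kernel (λ i → z i ℤ.- + a i)
  diameter-covers z
    with a , eq , z≈ ← walk⇒combination _ (proj₁ (proj₂ (distance ε (combination z gen)))) =
    a , ℕ.≤-trans (ℕ.≤-reflexive eq) (dist≤diameter _ _) ,
    Equivalence.from (Kernel-sub z (+_ ∘ a)) (trans z≈ (identityˡ _))

  -- The vector z expresses the difference of two vertices at maximal distance. Every nonnegative
  -- representative of its class gives a walk between them, hence is at least as long.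
  diameter-attained : ∃ λ z → ∀ (a : Vector ℕ d) →
    Kernel (λ i → z i ℤ.- + a i) → diameter ℕ.≤ ℕΣ.sum a
  diameter-attained
    with i , eqᵢ ← maximum-attained (λ i → maximum λ j → dist (element i) (element j)) (index ε)
    with j , eqⱼ ← maximum-attained (λ j → dist (element i) (element j)) (index ε)
    with z , z≈ ← gen-generates (element i ⁻¹ ∙ element j) = z , λ a k →
      subst (ℕ._≤ ℕΣ.sum a) (≡.trans eqⱼ eqᵢ)
        (proj₂ (proj₂ (distance (element i) (element j))) _
          (walk-respʳ (ℕΣ.sum a) (begin
            element i ∙ combination (+_ ∘ a) gen   ≈⟨ ∙-congˡ (Equivalence.to (Kernel-sub z (+_ ∘ a)) k) ⟨
            element i ∙ combination z gen          ≈⟨ ∙-congˡ z≈ ⟩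
            element i ∙ (element i ⁻¹ ∙ element j)   ≈⟨ \\-leftDividesˡ (element i) (element j) ⟩
            element j                              ∎)
          (combination⇒walk id a (element i))))


-- Order and diameter of two digraphs with comparable lattices.

module _ {d} (Γ Γ′ : CayleyDigraph d) where
  private
    module Γ = CayleyDigraph Γ
    module Γ′ = CayleyDigraph Γ′

  -- The inclusion of lattices makes the group of `Γ` a quotient of that of `Γ′`. A section of the
  -- quotient map, built from chosen coordinates of each element, injects the smaller group into the
  -- larger.
  Kernel-⊆⇒ord-≥ : (∀ a → Kernel Γ′ a → Kernel Γ a) → Γ.ord ℕ.≤ Γ′.ord
  Kernel-⊆⇒ord-≥ ⊆ = Fin.injective⇒≤ {f = f} λ {x} {y} fx≡fy →
    ≡.trans (≡.sym (Inverse.inverseʳ Γ.enumeration Γ.refl))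
      (Inverse.inverseʳ Γ.enumeration
        (Γ.trans (Γ.sym (proj₂ (coords x))) (Γ.trans (same x y fx≡fy) (proj₂ (coords y)))))
    where
    coords : ∀ x → ∃ λ a → Γ.combination a Γ.gen Γ.≈ Γ.element x
    coords x = Γ.gen-generates (Γ.element x)

    image : Fin Γ.ord → Γ′.Carrier
    image x = Γ′.combination (proj₁ (coords x)) Γ′.gen

    f : Fin Γ.ord → Fin Γ′.ord
    f x = Γ′.index (image x)

    same : ∀ x y → f x ≡ f y →
      Γ.combination (proj₁ (coords x)) Γ.gen Γ.≈ Γ.combination (proj₁ (coords y)) Γ.gen
    same x y fx≡fy = Equivalence.to (Kernel-sub Γ a b) (⊆ (λ i → a i ℤ.- b i) (Equivalence.from (Kernel-sub Γ′ a b)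
      (Γ′.trans (Γ′.sym (Γ′.element-index (image x)))
        (Γ′.trans (Γ′.reflexive (cong Γ′.element fx≡fy)) (Γ′.element-index (image y))))))
      where
      a = proj₁ (coords x)
      b = proj₁ (coords y)

  module _ (m : ℕ) .{{_ : NonZero m}}
    -- The lattice of `Γ′` is m L; the diameter is computed from this alone, without matrices.
    (scaled : ∀ a → Kernel Γ′ a ⇔ ∃ λ b → (∀ i → a i ≡ + m ℤ.* b i) × Kernel Γ b)
    where
    open ≡.≡-Reasoning

    -- Reducing z = m w + r to w costs at most m - 1 per coordinate.
    diameter-dilate-≤ : Γ′.diameter ℕ.≤ m ℕ.* Γ.diameter ℕ.+ d ℕ.* ℕ.pred m
    diameter-dilate-≤
      with z , attained ← diameter-attained Γ′
      with b , ∑b≤ , kernel ← diameter-covers Γ (λ i → z i ℤ./ℕ m) =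
      ℕ.≤-trans (attained a (Equivalence.from (scaled _) (_ , z-a≡ , kernel)))
        (ℕ.≤-trans (ℕ.≤-reflexive (sum-*-+ m b r))
          (ℕ.+-mono-≤ (ℕ.*-monoʳ-≤ m ∑b≤)
            (ℕ.≤-trans (sum-mono-≤ λ i → ℕ.<⇒≤pred (ℤ.n%ℕd<d (z i) m))
              (ℕ.≤-reflexive (sum-const d (ℕ.pred m))))))
      where
      r a : Vector ℕ d
      r i = z i ℤ.%ℕ m
      a i = m ℕ.* b i ℕ.+ r i

      z-a≡ : ∀ i → z i ℤ.- + a i ≡ + m ℤ.* (z i ℤ./ℕ m ℤ.- + b i)
      z-a≡ i = begin
        z i ℤ.- + a i
          ≡⟨ cong₂ ℤ._-_ (ℤ.a≡a%ℕn+[a/ℕn]*n (z i) m)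
               (≡.trans (ℤ.pos-+ (m ℕ.* b i) (r i)) (cong (ℤ._+ + r i) (ℤ.pos-* m (b i)))) ⟩
        + r i ℤ.+ (z i ℤ./ℕ m) ℤ.* + m ℤ.- (+ m ℤ.* + b i ℤ.+ + r i)
          ≡⟨ lemma (+ r i) (z i ℤ./ℕ m) (+ m) (+ b i) ⟩
        + m ℤ.* (z i ℤ./ℕ m ℤ.- + b i) ∎
        where
        lemma : ∀ r w m b → r ℤ.+ w ℤ.* m ℤ.- (m ℤ.* b ℤ.+ r) ≡ m ℤ.* (w ℤ.- b)
        lemma = solve-∀

    -- If w is a farthest point for Γ, then m w + (m - 1, …, m - 1) is one for Γ′.
    diameter-dilate-≥ : m ℕ.* Γ.diameter ℕ.+ d ℕ.* ℕ.pred m ℕ.≤ Γ′.diameter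
    diameter-dilate-≥
      with w , attained ← diameter-attained Γ
      with a , ∑a≤ , kernel′ ← diameter-covers Γ′ (λ i → + m ℤ.* w i ℤ.+ + ℕ.pred m)
      with c , z-a≡ , kernel ← Equivalence.to (scaled _) kernel′ = ℕ.≤-trans
        (ℕ.+-monoˡ-≤ (d ℕ.* ℕ.pred m) (ℕ.*-monoʳ-≤ m
          (attained b (Kernel-resp Γ c≡w-b kernel))))
        (ℕ.≤-trans (ℕ.≤-reflexive (≡.sym ∑a≡)) ∑a≤)
      where
      quotient : ∀ i → ∃ λ b → w i ℤ.- c i ≡ + b × a i ≡ m ℕ.* b ℕ.+ ℕ.pred m
      -- From z - a = m c and z = m w + (m - 1) follows a = m (w - c) + (m - 1), so w - c is a
      -- nonnegative representative of the class of w.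
      quotient i = quotient-nonneg m (a i) (w i ℤ.- c i) (begin
        + a i ≡⟨ lemma (+ m ℤ.* w i ℤ.+ + ℕ.pred m) (+ a i) ⟩
        (+ m ℤ.* w i ℤ.+ + ℕ.pred m) ℤ.- ((+ m ℤ.* w i ℤ.+ + ℕ.pred m) ℤ.- + a i)
          ≡⟨ cong (ℤ._-_ (+ m ℤ.* w i ℤ.+ + ℕ.pred m)) (z-a≡ i) ⟩
        (+ m ℤ.* w i ℤ.+ + ℕ.pred m) ℤ.- + m ℤ.* c i
          ≡⟨ lemma′ (+ m) (w i) (+ ℕ.pred m) (c i) ⟩
        + m ℤ.* (w i ℤ.- c i) ℤ.+ + ℕ.pred m ∎)
        where
        lemma : ∀ z a → a ≡ z ℤ.- (z ℤ.- a)
        lemma = solve-∀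
        lemma′ : ∀ m w p c → m ℤ.* w ℤ.+ p ℤ.- m ℤ.* c ≡ m ℤ.* (w ℤ.- c) ℤ.+ p
        lemma′ = solve-∀

      b : Vector ℕ d
      b = proj₁ ∘ quotient

      c≡w-b : ∀ i → c i ≡ w i ℤ.- + b i
      c≡w-b i = ≡.trans (lemma (w i) (c i)) (cong (ℤ._-_ (w i)) (proj₁ (proj₂ (quotient i))))
        where
        lemma : ∀ w c → c ≡ w ℤ.- (w ℤ.- c)
        lemma = solve-∀

      ∑a≡ : ℕΣ.sum a ≡ m ℕ.* ℕΣ.sum b ℕ.+ d ℕ.* ℕ.pred m
      ∑a≡ = ≡.trans (ℕΣ.sum-cong-≗ (proj₂ ∘ proj₂ ∘ quotient))
        (≡.trans (sum-*-+ m b λ _ → ℕ.pred m) (cong (m ℕ.* ℕΣ.sum b ℕ.+_) (sum-const d (ℕ.pred m))))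

    -- Adding d turns the term d (m - 1) into d m, which is why k + d, rather than k, scales
    -- exactly.
    diameter-dilate : Γ′.diameter ℕ.+ d ≡ m ℕ.* (Γ.diameter ℕ.+ d)
    diameter-dilate = begin
      Γ′.diameter ℕ.+ d
        ≡⟨ cong (ℕ._+ d) (ℕ.≤-antisym diameter-dilate-≤ diameter-dilate-≥) ⟩
      m ℕ.* Γ.diameter ℕ.+ d ℕ.* ℕ.pred m ℕ.+ d
        ≡⟨ ℕ.+-assoc (m ℕ.* Γ.diameter) (d ℕ.* ℕ.pred m) d ⟩
      m ℕ.* Γ.diameter ℕ.+ (d ℕ.* ℕ.pred m ℕ.+ d)
        ≡⟨ cong (m ℕ.* Γ.diameter ℕ.+_) (≡.trans (ℕ.+-comm _ d) (≡.sym (ℕ.*-suc d (ℕ.pred m)))) ⟩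
      m ℕ.* Γ.diameter ℕ.+ d ℕ.* suc (ℕ.pred m)
        ≡⟨ cong (λ k → m ℕ.* Γ.diameter ℕ.+ d ℕ.* k) (ℕ.suc-pred m) ⟩
      m ℕ.* Γ.diameter ℕ.+ d ℕ.* m
        ≡⟨ cong (m ℕ.* Γ.diameter ℕ.+_) (ℕ.*-comm d m) ⟩
      m ℕ.* Γ.diameter ℕ.+ m ℕ.* d
        ≡⟨ ℕ.*-distribˡ-+ m Γ.diameter d ⟨
      m ℕ.* (Γ.diameter ℕ.+ d) ∎

-- The lattice and the order of a dilate, by the Smith normal form.

open MatrixProperties

*ᵥ-scale : ∀ {d} (A : Matrix d) k x i → (A *ᵥ λ j → k ℤ.* x j) i ≡ k ℤ.* (A *ᵥ x) i
*ᵥ-scale A k x i = ≡.trans (ℤΣ.sum-cong-≗ λ j → lemma (A i j) k (x j))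
  (≡.sym (ℤΣ.*-distribˡ-sum k λ j → A i j ℤ.* x j))
  where
  lemma : ∀ a k x → a ℤ.* (k ℤ.* x) ≡ k ℤ.* (a ℤ.* x)
  lemma = solve-∀

∏-scale : ∀ m {d} (s : Vector ℕ d) → ∏ (λ i → m ℕ.* s i) ≡ m ℕ.^ d ℕ.* ∏ s
∏-scale m {zero}  s = ≡.refl
∏-scale m {suc d} s = ≡.trans (cong (m ℕ.* s zero ℕ.*_) (∏-scale m (s ∘ suc)))
  (lemma m (s zero) (m ℕ.^ d) (∏ (s ∘ suc)))
  where
  lemma : ∀ m s p q → m ℕ.* s ℕ.* (p ℕ.* q) ≡ m ℕ.* p ℕ.* (s ℕ.* q)
  lemma = ℕ-Solver.solve-∀

module _ {d} (Γ : CayleyDigraph d) {M : Matrix d}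
         (basis : IsKernelBasis Γ M) (smith : SmithDecomposition M) where
  open CayleyDigraph Γ using (ord; diameter)
  open IsKernelBasis basis
  open SmithDecomposition smith
  open Dilation Γ basis smith using (UMV-*ᵥ; U-injective)
  open ≡.≡-Reasoning

  private
    U⁻¹ = proj₁ U-unimodular
    V⁻¹ = proj₁ V-unimodular

    U-U⁻¹ : ∀ x i → (U *ᵥ (U⁻¹ *ᵥ x)) i ≡ x i
    U-U⁻¹ = cancelˡ U U⁻¹ (proj₁ (proj₂ U-unimodular))

    V-V⁻¹ : ∀ x i → (V *ᵥ (V⁻¹ *ᵥ x)) i ≡ x i
    V-V⁻¹ = cancelˡ V V⁻¹ (proj₁ (proj₂ V-unimodular))

  -- If a = M c, then U a = (U M V)(V⁻¹ c), and U M V is diagonal with entries `s`. Conversely the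
  -- quotients t give a = M (V t), because `U` is injective.
  Kernel-Smith : ∀ a → Kernel Γ a ⇔ (∀ i → + s i ℤ∣.∣ (U *ᵥ a) i)
  Kernel-Smith a = mk⇔ to from
    where
    to : Kernel Γ a → ∀ i → + s i ℤ∣.∣ (U *ᵥ a) i
    to k i with c , a≡Mc ← Equivalence.to (spans a) k = divides ((V⁻¹ *ᵥ c) i) (begin
      (U *ᵥ a) i                             ≡⟨ *ᵥ-congʳ U a≡Mc i ⟩
      (U *ᵥ (M *ᵥ c)) i                      ≡⟨ *ᵥ-congʳ U (*ᵥ-congʳ M (V-V⁻¹ c)) i ⟨
      (U *ᵥ (M *ᵥ (V *ᵥ (V⁻¹ *ᵥ c)))) i      ≡⟨ UMV-*ᵥ (V⁻¹ *ᵥ c) i ⟩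
      + s i ℤ.* (V⁻¹ *ᵥ c) i                 ≡⟨ ℤ.*-comm (+ s i) _ ⟩
      (V⁻¹ *ᵥ c) i ℤ.* + s i                 ∎)
    from : (∀ i → + s i ℤ∣.∣ (U *ᵥ a) i) → Kernel Γ a
    from s∣ = Equivalence.from (spans a) (V *ᵥ t , U-injective a (M *ᵥ (V *ᵥ t)) λ i → begin
      (U *ᵥ a) i                  ≡⟨ ℤ∣._∣_.equality (s∣ i) ⟩
      t i ℤ.* + s i               ≡⟨ ℤ.*-comm (t i) (+ s i) ⟩
      + s i ℤ.* t i               ≡⟨ UMV-*ᵥ t i ⟨
      (U *ᵥ (M *ᵥ (V *ᵥ t))) i    ∎)
      where
      t : Vector ℤ d
      t i = ℤ∣.quotient (s∣ i)

  module _ (m : ℕ) .{{_ : NonZero m}} where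
    private
      mΓ = dilate Γ basis smith m

    Kernel-dilate : ∀ a → Kernel mΓ a ⇔ ∃ λ b → (∀ i → a i ≡ + m ℤ.* b i) × Kernel Γ b
    Kernel-dilate a = mk⇔ to from
      where
      -- Equality with `ε` in the cyclic sum unfolds to divisibility of a difference, hence the
      -- subtracted zero.
      U≡ : ∀ i → CayleyDigraph.combination mΓ a (CayleyDigraph.gen mΓ) i ℤ.- 0ℤ ≡ (U *ᵥ a) i
      U≡ i = ≡.trans (ℤ.+-identityʳ _) (combination-pointwise (λ i → m ℕ.* s i) a (column U) i)

      to : Kernel mΓ a → ∃ λ b → (∀ i → a i ≡ + m ℤ.* b i) × Kernel Γ b
      -- Here U a = m y with y = t s, so b = U⁻¹ y satisfies a = m b, and U b = y is still divisible
      -- by `s`.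
      to k = U⁻¹ *ᵥ y ,
        U-injective a (λ i → + m ℤ.* (U⁻¹ *ᵥ y) i) (λ i → begin
          (U *ᵥ a) i                             ≡⟨ U≡ i ⟨
          _                                      ≡⟨ ℤ∣._∣_.equality (k i) ⟩
          t i ℤ.* + (m ℕ.* s i)                  ≡⟨ cong (t i ℤ.*_) (ℤ.pos-* m (s i)) ⟩
          t i ℤ.* (+ m ℤ.* + s i)                ≡⟨ lemma (t i) (+ m) (+ s i) ⟩
          + m ℤ.* y i                            ≡⟨ cong (+ m ℤ.*_) (U-U⁻¹ y i) ⟨
          + m ℤ.* (U *ᵥ (U⁻¹ *ᵥ y)) i            ≡⟨ *ᵥ-scale U (+ m) (U⁻¹ *ᵥ y) i ⟨
          (U *ᵥ λ i → + m ℤ.* (U⁻¹ *ᵥ y) i) i    ∎) ,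
        Equivalence.from (Kernel-Smith (U⁻¹ *ᵥ y)) (λ i → divides (t i) (U-U⁻¹ y i))
        where
        t y : Vector ℤ d
        t i = ℤ∣.quotient (k i)
        y i = t i ℤ.* + s i
        lemma : ∀ t m s → t ℤ.* (m ℤ.* s) ≡ m ℤ.* (t ℤ.* s)
        lemma = solve-∀

      from : (∃ λ b → (∀ i → a i ≡ + m ℤ.* b i) × Kernel Γ b) → Kernel mΓ a
      from (b , a≡mb , k) i = divides (t i) (begin
        _                              ≡⟨ U≡ i ⟩
        (U *ᵥ a) i                     ≡⟨ *ᵥ-congʳ U a≡mb i ⟩
        (U *ᵥ λ i → + m ℤ.* b i) i     ≡⟨ *ᵥ-scale U (+ m) b i ⟩
        + m ℤ.* (U *ᵥ b) i             ≡⟨ cong (+ m ℤ.*_) (ℤ∣._∣_.equality (s∣Ub i)) ⟩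
        + m ℤ.* (t i ℤ.* + s i)        ≡⟨ lemma (t i) (+ m) (+ s i) ⟩
        t i ℤ.* (+ m ℤ.* + s i)        ≡⟨ cong (t i ℤ.*_) (ℤ.pos-* m (s i)) ⟨
        t i ℤ.* + (m ℕ.* s i)          ∎)
        where
        s∣Ub = Equivalence.to (Kernel-Smith b) k
        t : Vector ℤ d
        t i = ℤ∣.quotient (s∣Ub i)
        lemma : ∀ t m s → m ℤ.* (t ℤ.* s) ≡ t ℤ.* (m ℤ.* s)
        lemma = solve-∀

    dilate-diameter : CayleyDigraph.diameter mΓ ℕ.+ d ≡ m ℕ.* (diameter ℕ.+ d)
    dilate-diameter = diameter-dilate Γ mΓ m Kernel-dilate

  -- The order of `Γ` comes with an arbitrary enumeration, while that of a dilate is a product by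
  -- construction. The dilate by 1 has the same lattice as `Γ`, which links `ord` to `∏ s`.
  dilate-1-ord : CayleyDigraph.ord (dilate Γ basis smith 1) ≡ ord
  dilate-1-ord = ℕ.≤-antisym
    (Kernel-⊆⇒ord-≥ 1Γ Γ λ a k →
      Equivalence.from (Kernel-dilate 1 a) (a , (λ i → ≡.sym (ℤ.*-identityˡ (a i))) , k))
    (Kernel-⊆⇒ord-≥ Γ 1Γ λ a k →
      let b , a≡1b , kb = Equivalence.to (Kernel-dilate 1 a) k in
      Kernel-resp Γ (λ i → ≡.trans (≡.sym (ℤ.*-identityˡ (b i))) (≡.sym (a≡1b i))) kb)
    where
    1Γ = dilate Γ basis smith 1

  dilate-ord : ∀ m .{{_ : NonZero m}} →
    CayleyDigraph.ord (dilate Γ basis smith m) ≡ m ℕ.^ d ℕ.* ord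
  dilate-ord m = begin
    ∏ (λ i → m ℕ.* s i)                ≡⟨ ∏-scale m s ⟩
    m ℕ.^ d ℕ.* ∏ s                    ≡⟨ cong (m ℕ.^ d ℕ.*_) ∏s≡ord ⟩
    m ℕ.^ d ℕ.* ord                    ∎
    where
    ∏s≡ord : ∏ s ≡ ord
    ∏s≡ord = begin
      ∏ s                      ≡⟨ ℕ.*-identityˡ (∏ s) ⟨
      1 ℕ.* ∏ s                ≡⟨ cong (ℕ._* ∏ s) (ℕ.^-zeroˡ d) ⟨
      1 ℕ.^ d ℕ.* ∏ s          ≡⟨ ∏-scale 1 s ⟨
      ∏ (λ i → 1 ℕ.* s i)      ≡⟨ dilate-1-ord ⟩
      ord                      ∎

-- Roots, ceilings and floors in a complete ordered field.

module OrderedField (ℝ : CompleteOrderedField) where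
  open Reals ℝ
  open RealsProperties ℝ
  open RealFunctions ℝ
  open RingProperties ring
  module ≤ = IsDecTotalOrder isDecTotalOrder

  ≤-poset : Poset 0ℓ 0ℓ 0ℓ
  ≤-poset = record { isPartialOrder = ≤.isPartialOrder }

  open import Relation.Binary.Reasoning.PartialOrder ≤-poset

  ≰⇒≥ : ∀ {x y} → ¬ x ≤ y → y ≤ x
  ≰⇒≥ {x} {y} x≰y with ≤.total x y
  ... | inj₁ x≤y = contradiction x≤y x≰y
  ... | inj₂ y≤x = y≤x

  neg-≤ : ∀ {x y} → x ≤ y → - y ≤ - x
  neg-≤ {x} {y} x≤y = +-cancelˡ-≤ x (begin
    x - y ≤⟨ +-monoˡ-≤ (- y) x≤y ⟩
    y - y ≈⟨ -‿inverseʳ y ⟩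
    0#    ≈⟨ -‿inverseʳ x ⟨
    x - x ∎)

  x+y≤z⇔y≤z-x : ∀ {x y z} → x + y ≤ z ⇔ y ≤ z - x
  x+y≤z⇔y≤z-x {x} {y} {z} = mk⇔
    (λ x+y≤z → +-cancelˡ-≤ x (≤.trans x+y≤z (≤.reflexive (sym (sub-add x z)))))
    (λ y≤z-x → ≤.trans (+-monoʳ-≤ x y≤z-x) (≤.reflexive (sub-add x z)))

  ⁻¹-cancel : ∀ {z} x → ¬ z ≈ 0# → z ⁻¹ * (z * x) ≈ x
  ⁻¹-cancel {z} x z≉0 = begin-equality
    z ⁻¹ * (z * x) ≈⟨ *-assoc (z ⁻¹) z x ⟨
    z ⁻¹ * z * x   ≈⟨ *-congʳ (trans (*-comm (z ⁻¹) z) (⁻¹-inverseʳ z≉0)) ⟩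
    1# * x         ≈⟨ *-identityˡ x ⟩
    x              ∎

  *-cancelˡ-≤ : ∀ {z x y} → 0# ≤ z → ¬ z ≈ 0# → z * x ≤ z * y → x ≤ y
  *-cancelˡ-≤ {z} {x} {y} 0≤z z≉0 zx≤zy = begin
    x              ≈⟨ ⁻¹-cancel x z≉0 ⟨
    z ⁻¹ * (z * x) ≤⟨ *-monoʳ-≤ (⁻¹-nonneg 0≤z z≉0) zx≤zy ⟩
    z ⁻¹ * (z * y) ≈⟨ ⁻¹-cancel y z≉0 ⟩
    y              ∎

  *-≉0 : ∀ {x y} → ¬ x ≈ 0# → ¬ y ≈ 0# → ¬ x * y ≈ 0#
  *-≉0 {x} {y} x≉0 y≉0 xy≈0 = y≉0 (begin-equality
    y              ≈⟨ ⁻¹-cancel y x≉0 ⟨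
    x ⁻¹ * (x * y) ≈⟨ *-congˡ xy≈0 ⟩
    x ⁻¹ * 0#      ≈⟨ zeroʳ (x ⁻¹) ⟩
    0#             ∎)

  ⁻¹-≉0 : ∀ {x} → ¬ x ≈ 0# → ¬ x ⁻¹ ≈ 0#
  ⁻¹-≉0 {x} x≉0 x⁻¹≈0 = 0≉1 (begin-equality
    0#       ≈⟨ zeroʳ x ⟨
    x * 0#   ≈⟨ *-congˡ x⁻¹≈0 ⟨
    x * x ⁻¹ ≈⟨ ⁻¹-inverseʳ x≉0 ⟩
    1#       ∎)

  ^-≉0 : ∀ {x} d → ¬ x ≈ 0# → ¬ x ^ d ≈ 0#
  ^-≉0 zero    x≉0 1≈0 = 0≉1 (sym 1≈0)
  ^-≉0 (suc d) x≉0     = *-≉0 x≉0 (^-≉0 d x≉0)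

  ^-cancel-≤ : ∀ d .{{_ : NonZero d}} {x y} → 0# ≤ x → 0# ≤ y → x ^ d ≤ y ^ d → x ≤ y
  ^-cancel-≤ (suc d) {x} {y} 0≤x 0≤y x^d≤y^d with ≤.total x y | x ≟ 0#
  ... | inj₁ x≤y | _       = x≤y
  ... | inj₂ y≤x | yes x≈0 = ≤.trans (≤.reflexive x≈0) 0≤y
  -- Since y ≤ x, the larger power bounds the smaller one, and the nonzero factor `x ^ d` can be
  -- cancelled.
  ... | inj₂ y≤x | no  x≉0 = *-cancelˡ-≤ (^-nonneg d 0≤x) (^-≉0 d x≉0) (begin
    x ^ d * x ≈⟨ *-comm (x ^ d) x ⟩
    x * x ^ d ≤⟨ x^d≤y^d ⟩
    y * y ^ d ≤⟨ *-monoʳ-≤ 0≤y (^-mono-≤ d 0≤y y≤x) ⟩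
    y * x ^ d ≈⟨ *-comm y (x ^ d) ⟩
    x ^ d * y ∎)

  root-isRoot : ∀ d .{{_ : NonZero d}} {x} → 0# ≤ x → IsRoot d x (root d x)
  root-isRoot d {x} 0≤x with 0# ≤? x
  ... | yes 0≤x′ = proj₂ (root-exists d 0≤x′)
  ... | no  0≰x  = contradiction 0≤x 0≰x

  root-unique : ∀ d .{{_ : NonZero d}} {x y y′} → IsRoot d x y → IsRoot d x y′ → y ≈ y′
  root-unique d (0≤y , y^d≈x) (0≤y′ , y′^d≈x) = ≤.antisym
    (^-cancel-≤ d 0≤y 0≤y′ (≤.reflexive (trans y^d≈x (sym y′^d≈x))))
    (^-cancel-≤ d 0≤y′ 0≤y (≤.reflexive (trans y′^d≈x (sym y^d≈x))))

  fromℕ-* : ∀ m n → fromℕ (m ℕ.* n) ≈ fromℕ m * fromℕ n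
  fromℕ-* = SemiringMult.×1-homo-* semiring

  fromℕ-^ : ∀ m d → fromℕ (m ℕ.^ d) ≈ fromℕ m ^ d
  fromℕ-^ m zero    = +-identityʳ 1#
  fromℕ-^ m (suc d) = trans (fromℕ-* m (m ℕ.^ d)) (*-congˡ (fromℕ-^ m d))

  fromℤ-neg : ∀ n → fromℤ (ℤ.- + n) ≈ - fromℕ n
  fromℤ-neg zero    = sym -0#≈0#
  fromℤ-neg (suc n) = refl

  fromℕ≉0 : ∀ n .{{_ : NonZero n}} → ¬ fromℕ n ≈ 0#
  fromℕ≉0 (suc n) n≈0 = fromℕ[1+n]≰0 n (≤.reflexive n≈0)

  ceiling-unique : ∀ {x a b} → IsCeiling x a → IsCeiling x b → a ≡ b
  ceiling-unique (x≤a , a-least) (x≤b , b-least) =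
    ℤ.≤-antisym (a-least _ x≤b) (b-least _ x≤a)

  ⌈⌉-isCeiling : ∀ x → IsCeiling x ⌈ x ⌉
  ⌈⌉-isCeiling x = proj₂ (ceiling x)

  -- By totality, a failure would give `fromℤ b ≤ fromℤ a`, hence b ≤ a and a = b.
  fromℤ-mono-≤ : ∀ {a b} → a ℤ.≤ b → fromℤ a ≤ fromℤ b
  fromℤ-mono-≤ {a} {b} a≤b with fromℤ a ≤? fromℤ b
  ... | yes fa≤fb = fa≤fb
  ... | no  fa≰fb with ≡.refl ← ℤ.≤-antisym a≤b (fromℤ-cancel-≤ b a (≰⇒≥ fa≰fb)) =
    contradiction ≤.refl fa≰fb

  -- The floor is the negated ceiling of - x, so both directions are the defining properties of that
  -- ceiling with signs reversed.
  fromℤ-≤-⌊⌋ : ∀ x n → fromℕ n ≤ fromℤ ⌊ x ⌋ ⇔ fromℕ n ≤ x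
  fromℤ-≤-⌊⌋ x n = mk⇔ to from
    where
    to : fromℕ n ≤ fromℤ ⌊ x ⌋ → fromℕ n ≤ x
    to n≤ = begin
      fromℕ n        ≈⟨ -‿involutive (fromℕ n) ⟨
      - - fromℕ n    ≤⟨ neg-≤ -x≤-n ⟩
      - - x          ≈⟨ -‿involutive x ⟩
      x              ∎
      where
      -x≤-n : - x ≤ - fromℕ n
      -x≤-n = begin
        - x                        ≤⟨ proj₁ (⌈⌉-isCeiling (- x)) ⟩
        fromℤ ⌈ - x ⌉              ≤⟨ fromℤ-mono-≤ (subst (ℤ._≤ ℤ.- + n) (ℤ.neg-involutive ⌈ - x ⌉)
                                        (ℤ.neg-mono-≤ (fromℤ-cancel-≤ (+ n) ⌊ x ⌋ n≤))) ⟩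
        fromℤ (ℤ.- + n)            ≈⟨ fromℤ-neg n ⟩
        - fromℕ n                  ∎
    from : fromℕ n ≤ x → fromℕ n ≤ fromℤ ⌊ x ⌋
    from n≤x = fromℤ-mono-≤ (subst (ℤ._≤ ⌊ x ⌋) (ℤ.neg-involutive (+ n)) (ℤ.neg-mono-≤
      (proj₂ (⌈⌉-isCeiling (- x)) (ℤ.- + n)
        (≤.trans (neg-≤ n≤x) (≤.reflexive (sym (fromℤ-neg n)))))))

  -- Given x ≤ n, the ceiling is n unless n - 1 is already an upper bound of x. The negated
  -- inequality expresses n - x < 1 through `_≤_`; the predecessor is an integer because n may be 0.
  ⌈⌉≡⇔ : ∀ {x} {n} → x ≤ fromℕ n → ⌈ x ⌉ ≡ + n ⇔ (¬ 1# ≤ fromℕ n - x)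
  ⌈⌉≡⇔ {x} {n} x≤n = mk⇔ to from
    where
    n-1 : ℤ
    n-1 = ℤ.pred (+ n)

    fromℤ-n-1 : fromℤ n-1 ≈ fromℕ n - 1#
    fromℤ-n-1 = begin-equality
      fromℤ n-1             ≈⟨ fromℤ-homo-+ ℤ.-1ℤ (+ n) ⟩
      fromℤ ℤ.-1ℤ + fromℕ n ≈⟨ +-comm (fromℤ ℤ.-1ℤ) (fromℕ n) ⟩
      fromℕ n + fromℤ ℤ.-1ℤ ≈⟨ +-congˡ (-‿cong (+-identityʳ 1#)) ⟩
      fromℕ n - 1#          ∎

    x≤n-1⇔ : x ≤ fromℤ n-1 ⇔ 1# ≤ fromℕ n - x
    x≤n-1⇔ = mk⇔
      (λ x≤n-1 → Equivalence.to x+y≤z⇔y≤z-x (begin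
        x + 1# ≈⟨ +-comm x 1# ⟩
        1# + x ≤⟨ Equivalence.from x+y≤z⇔y≤z-x (≤.trans x≤n-1 (≤.reflexive fromℤ-n-1)) ⟩
        fromℕ n ∎))
      (λ 1≤n-x → ≤.trans (Equivalence.to x+y≤z⇔y≤z-x (begin
        1# + x ≈⟨ +-comm 1# x ⟩
        x + 1# ≤⟨ Equivalence.from x+y≤z⇔y≤z-x 1≤n-x ⟩
        fromℕ n ∎)) (≤.reflexive (sym fromℤ-n-1)))

    to : ⌈ x ⌉ ≡ + n → ¬ 1# ≤ fromℕ n - x
    to eq 1≤n-x = ℤ.<-irrefl ≡.refl (ℤ.i≤pred[j]⇒i<j
      (subst (ℤ._≤ n-1) eq (proj₂ (⌈⌉-isCeiling x) n-1 (Equivalence.from x≤n-1⇔ 1≤n-x))))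

    from : ¬ 1# ≤ fromℕ n - x → ⌈ x ⌉ ≡ + n
    from 1≰n-x = ceiling-unique (⌈⌉-isCeiling x) (x≤n , λ b x≤b →
      ℤ.≮⇒≥ λ b<n → 1≰n-x (Equivalence.to x≤n-1⇔
        (≤.trans x≤b (fromℤ-mono-≤ (ℤ.i<j⇒i≤pred[j] b<n)))))

  1/x≤y⇔ : ∀ {x y} → 0# ≤ x → ¬ x ≈ 0# → 1# / x ≤ y ⇔ 1# ≤ y * x
  1/x≤y⇔ {x} {y} 0≤x x≉0 = mk⇔
    (λ 1/x≤y → begin
      1#           ≈⟨ x*1/x≈1 ⟨
      x * (1# / x) ≤⟨ *-monoʳ-≤ 0≤x 1/x≤y ⟩
      x * y        ≈⟨ *-comm x y ⟩
      y * x        ∎)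
    (λ 1≤yx → *-cancelˡ-≤ 0≤x x≉0 (begin
      x * (1# / x) ≈⟨ x*1/x≈1 ⟩
      1#           ≤⟨ 1≤yx ⟩
      y * x        ≈⟨ *-comm y x ⟩
      x * y        ∎))
    where
    x*1/x≈1 : x * (1# / x) ≈ 1#
    x*1/x≈1 = trans (*-congˡ (*-identityˡ (x ⁻¹))) (⁻¹-inverseʳ x≉0)

  module _ {r K} (⌈r⌉≡K : ⌈ r ⌉ ≡ + K) (r∉ℕ : ¬ IsNatural r) where
    private
      ⟦r⟧≈K-r : ⟦ r ⟧ ≈ fromℕ K - r
      ⟦r⟧≈K-r = +-congʳ (reflexive (cong fromℤ ⌈r⌉≡K))

      r≤K : r ≤ fromℕ K
      r≤K = subst (λ a → r ≤ fromℤ a) ⌈r⌉≡K (proj₁ (⌈⌉-isCeiling r))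

    ⟦⟧-nonneg : 0# ≤ ⟦ r ⟧
    ⟦⟧-nonneg = x≤y⇒0≤y-x (proj₁ (⌈⌉-isCeiling r))

    ⟦⟧≉0 : ¬ ⟦ r ⟧ ≈ 0#
    ⟦⟧≉0 ⟦r⟧≈0 = r∉ℕ (K , (begin-equality
      r                 ≈⟨ +-identityʳ r ⟨
      r + 0#            ≈⟨ +-congˡ (trans (sym ⟦r⟧≈0) ⟦r⟧≈K-r) ⟩
      r + (fromℕ K - r) ≈⟨ sub-add r (fromℕ K) ⟩
      fromℕ K           ∎))

    -- ⌈m r⌉ = m K iff m K - m r < 1, i.e. m ⟦r⟧ < 1.
    ⌈⌉-scale : ∀ {r′} m → r′ ≈ fromℕ m * r →
      ⌈ r′ ⌉ ≡ + (m ℕ.* K) ⇔ (¬ 1# / ⟦ r ⟧ ≤ fromℕ m)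
    ⌈⌉-scale {r′} m r′≈mr = mk⇔
      (λ eq ≤m → Equivalence.to ⌈r′⌉⇔ eq (begin
        1#                   ≤⟨ Equivalence.to ≤m⇔ ≤m ⟩
        fromℕ m * ⟦ r ⟧      ≈⟨ mK-r′≈m⟦r⟧ ⟨
        fromℕ (m ℕ.* K) - r′ ∎))
      (λ ≰m → Equivalence.from ⌈r′⌉⇔ λ 1≤ → ≰m (Equivalence.from ≤m⇔ (begin
        1#                   ≤⟨ 1≤ ⟩
        fromℕ (m ℕ.* K) - r′ ≈⟨ mK-r′≈m⟦r⟧ ⟩
        fromℕ m * ⟦ r ⟧      ∎)))
      where
      ≤m⇔ = 1/x≤y⇔ {⟦ r ⟧} {fromℕ m} ⟦⟧-nonneg ⟦⟧≉0

      r′≤mK : r′ ≤ fromℕ (m ℕ.* K)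
      r′≤mK = begin
        r′                ≈⟨ r′≈mr ⟩
        fromℕ m * r       ≤⟨ *-monoʳ-≤ (0≤fromℕ m) r≤K ⟩
        fromℕ m * fromℕ K ≈⟨ fromℕ-* m K ⟨
        fromℕ (m ℕ.* K)   ∎

      ⌈r′⌉⇔ = ⌈⌉≡⇔ {r′} {m ℕ.* K} r′≤mK

      mK-r′≈m⟦r⟧ : fromℕ (m ℕ.* K) - r′ ≈ fromℕ m * ⟦ r ⟧
      mK-r′≈m⟦r⟧ = begin-equality
        fromℕ (m ℕ.* K) - r′              ≈⟨ +-cong (fromℕ-* m K) (-‿cong r′≈mr) ⟩
        fromℕ m * fromℕ K - fromℕ m * r   ≈⟨ x[y-z]≈xy-xz (fromℕ m) (fromℕ K) r ⟨
        fromℕ m * (fromℕ K - r)           ≈⟨ *-congˡ ⟦r⟧≈K-r ⟨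
        fromℕ m * ⟦ r ⟧                   ∎

-- The bound c(d, n), the scaled root and tightness.

module _ (ℝ : CompleteOrderedField) where
  open Tightness ℝ
  open RealsProperties ℝ hiding (isNatural?; fromℕ-/-≤1)
  open OrderedField ℝ
  open CayleyDigraph using (ord; diameter)
  open import Relation.Binary.Reasoning.PartialOrder ≤-poset

  -- Both branches of `c` encode m < β. For a natural β this is m + 1 ≤ β; otherwise m ≤ ⌊β⌋ gives m
  -- ≤ β, and equality would make β natural.
  ≤-c⇔ : ∀ d .{{_ : NonZero d}} n m → fromℕ m ≤ c d n ⇔ (¬ β d n ≤ fromℕ m)
  ≤-c⇔ d n m with isNatural? (β d n)
  ... | yes (p , β≈p) = mk⇔
    (λ m≤β-1 β≤m → 1≰0 (x+y≤x⇒y≤0 (fromℕ m) (begin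
      fromℕ m + 1# ≈⟨ +-comm (fromℕ m) 1# ⟩
      1# + fromℕ m ≤⟨ Equivalence.from x+y≤z⇔y≤z-x m≤β-1 ⟩
      β d n        ≤⟨ β≤m ⟩
      fromℕ m      ∎)))
    (λ β≰m → Equivalence.to x+y≤z⇔y≤z-x (begin
      fromℕ (suc m) ≤⟨ fromℕ-mono-≤ {suc m} {p} (ℕ.≰⇒> λ p≤m → β≰m
                         (≤.trans (≤.reflexive β≈p) (fromℕ-mono-≤ {p} {m} p≤m))) ⟩
      fromℕ p       ≈⟨ β≈p ⟨
      β d n         ∎))
  ... | no β∉ℕ = mk⇔
    (λ m≤⌊β⌋ β≤m → β∉ℕ (m , ≤.antisym β≤m (Equivalence.to (fromℤ-≤-⌊⌋ (β d n) m) m≤⌊β⌋)))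
    (λ β≰m → Equivalence.from (fromℤ-≤-⌊⌋ (β d n) m) (≰⇒≥ β≰m))

  module _ {d} .{{_ : NonZero d}} (Γ : CayleyDigraph d) where
    private
      instance
        ord≢0 : NonZero (ord Γ)
        ord≢0 = Fin.nonZeroIndex (CayleyDigraph.index Γ (CayleyDigraph.ε Γ))

      k+d = diameter Γ ℕ.+ d

      [k+d]^d≉0 : ¬ fromℕ (k+d ℕ.^ d) ≈ 0#
      [k+d]^d≉0 = fromℕ≉0 (k+d ℕ.^ d) {{ℕ.m^n≢0 k+d d
        {{ℕ.>-nonZero (ℕ.≤-trans (ℕ.>-nonZero⁻¹ d) (ℕ.m≤n+m d (diameter Γ)))}}}}

    solidDensity-nonneg : 0# ≤ solidDensity Γ
    solidDensity-nonneg =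
      *-nonneg (0≤fromℕ (ord Γ)) (⁻¹-nonneg (0≤fromℕ (k+d ℕ.^ d)) [k+d]^d≉0)

    solidDensity≤Δ : solidDensity Γ ≤ Δ d
    solidDensity≤Δ = proj₁ (proj₂ (solidDensity-supremum d)) (solidDensity Γ) (Γ , refl)

    Δ-nonneg : 0# ≤ Δ d
    Δ-nonneg = ≤.trans solidDensity-nonneg solidDensity≤Δ

    -- The digraph `Γ` itself witnesses positivity: its order is nonzero because the group contains
    -- `ε`, so its density is positive and bounds `Δ d` from below.
    Δ≉0 : ¬ Δ d ≈ 0#
    Δ≉0 Δ≈0 = *-≉0 (fromℕ≉0 (ord Γ)) (⁻¹-≉0 [k+d]^d≉0)
      (≤.antisym (≤.trans solidDensity≤Δ (≤.reflexive Δ≈0)) solidDensity-nonneg)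

    scaledRoot-isRoot : ∀ n → IsRoot d (fromℕ n / Δ d) (scaledRoot d n)
    scaledRoot-isRoot n = root-isRoot d (*-nonneg (0≤fromℕ n) (⁻¹-nonneg Δ-nonneg Δ≉0))

    -- The right side is a nonnegative number with the required d-th power, and such roots are
    -- unique.
    scaledRoot-dilate : ∀ m n → scaledRoot d (m ℕ.^ d ℕ.* n) ≈ fromℕ m * scaledRoot d n
    scaledRoot-dilate m n with 0≤r , r^d≈ ← scaledRoot-isRoot n =
      root-unique d (scaledRoot-isRoot (m ℕ.^ d ℕ.* n))
        (*-nonneg (0≤fromℕ m) 0≤r , (begin-equality
          (fromℕ m * scaledRoot d n) ^ d        ≈⟨ Exp.^-distrib-* commutativeSemiring (fromℕ m) (scaledRoot d n) d ⟩
          fromℕ m ^ d * scaledRoot d n ^ d      ≈⟨ *-congˡ r^d≈ ⟩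
          fromℕ m ^ d * (fromℕ n / Δ d)         ≈⟨ *-assoc _ _ _ ⟨
          fromℕ m ^ d * fromℕ n / Δ d           ≈⟨ *-congʳ (*-congʳ (fromℕ-^ m d)) ⟨
          fromℕ (m ℕ.^ d) * fromℕ n / Δ d       ≈⟨ *-congʳ (fromℕ-* (m ℕ.^ d) n) ⟨
          fromℕ (m ℕ.^ d ℕ.* n) / Δ d           ∎))

    Δ*scaledRoot^d : ∀ n → Δ d * scaledRoot d n ^ d ≈ fromℕ n
    Δ*scaledRoot^d n = begin-equality
      Δ d * scaledRoot d n ^ d    ≈⟨ *-congˡ (proj₂ (scaledRoot-isRoot n)) ⟩
      Δ d * (fromℕ n * Δ d ⁻¹)    ≈⟨ *-congˡ (*-comm (fromℕ n) (Δ d ⁻¹)) ⟩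
      Δ d * (Δ d ⁻¹ * fromℕ n)    ≈⟨ *-assoc _ _ _ ⟨
      Δ d * Δ d ⁻¹ * fromℕ n      ≈⟨ *-congʳ (⁻¹-inverseʳ Δ≉0) ⟩
      1# * fromℕ n                ≈⟨ *-identityˡ (fromℕ n) ⟩
      fromℕ n                     ∎

    Tight⇔ : Tight Γ ⇔ ⌈ scaledRoot d (ord Γ) ⌉ ≡ + k+d
    Tight⇔ = mk⇔
      (λ t → ≡.trans (lemma ⌈r⌉ (+ diameter Γ) (+ d)) (≡.trans
        (cong (ℤ._-_ (+ diameter Γ ℤ.+ + d)) t) (ℤ.+-identityʳ (+ k+d))))
      (λ eq → ≡.trans (cong (λ a → + diameter Γ ℤ.- (a ℤ.- + d)) eq)
        (lemma′ (+ diameter Γ) (+ d)))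
      where
      ⌈r⌉ = ⌈ scaledRoot d (ord Γ) ⌉
      lemma : ∀ a k d → a ≡ k ℤ.+ d ℤ.- (k ℤ.- (a ℤ.- d))
      lemma = solve-∀
      lemma′ : ∀ k d → k ℤ.- (k ℤ.+ d ℤ.- d) ≡ 0ℤ
      lemma′ = solve-∀

theorem5 : (ℝ : CompleteOrderedField) →
    let open Tightness ℝ
        open CayleyDigraph using (ord) in
    (d : ℕ) .{{_ : NonZero d}} (Γ : CayleyDigraph d) →
    Tight Γ →
    (∀ x → x ∈ C d → x ∈ IsNatural → ¬ fromℕ (ord Γ) ≈ Δ d * x ^ d) →
    {M : Matrix d} (basis : IsKernelBasis Γ M) (smith : SmithDecomposition M) →
    (m : ℕ) .{{_ : NonZero m}} →
    Tight (dilate Γ basis smith m) ⇔ (1 ℕ.≤ m × fromℕ m ≤ c d (ord Γ))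
theorem5 ℝ d Γ tight n≉Δxᵈ basis smith m = mk⇔
  (λ t → ℕ.>-nonZero⁻¹ m , Equivalence.from (≤-c⇔ ℝ d n m) (Equivalence.to ⌈r′⌉≡mK⇔
    (≡.trans (Equivalence.to (Tight⇔ ℝ mΓ) t) (cong +_ k′+d≡mK))))
  (λ (_ , m≤c) → Equivalence.from (Tight⇔ ℝ mΓ) (≡.trans
    (Equivalence.from ⌈r′⌉≡mK⇔ (Equivalence.to (≤-c⇔ ℝ d n m) m≤c)) (cong +_ (≡.sym k′+d≡mK))))
  where
  open Tightness ℝ
  open OrderedField ℝ
  open CayleyDigraph using (ord; diameter)

  mΓ = dilate Γ basis smith m
  n = ord Γ
  K = diameter Γ ℕ.+ d
  r = scaledRoot d n
  k′+d≡mK = dilate-diameter Γ basis smith m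

  r∉ℕ : ¬ IsNatural r
  -- The hypothesis on n is applied to x = r, which lies in `C d` because Δ r^d is the natural
  -- number n.
  r∉ℕ r∈ℕ = n≉Δxᵈ r (n , Δ*scaledRoot^d ℝ Γ n) r∈ℕ (sym (Δ*scaledRoot^d ℝ Γ n))

  r′≈mr : scaledRoot d (ord mΓ) ≈ fromℕ m * r
  r′≈mr = trans (reflexive (cong (scaledRoot d) (dilate-ord Γ basis smith m)))
    (scaledRoot-dilate ℝ Γ m n)

  ⌈r′⌉≡mK⇔ : ⌈ scaledRoot d (ord mΓ) ⌉ ≡ + (m ℕ.* K) ⇔ (¬ β d n ≤ fromℕ m)
  ⌈r′⌉≡mK⇔ = ⌈⌉-scale {r} {K} (Equivalence.to (Tight⇔ ℝ Γ) tight) r∉ℕ m r′≈mr
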